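{- Let $F$ be a digraph, let $v_0\in V(F)$, let $k\ge 1$ and let $Q\in\mathscr{S}_k$ be a good subdigraph of $\overleftrightarrow{P_k}$, where $P_k=v_1v_2\ldots v_k$ and $\{v_1,\ldots,v_k\}$ is disjoint from $V(F)$. Let $F^*$ be the digraph obtained from $F$ by adding $Q$, both arcs $(v_0,v_1)$ and $(v_1,v_0)$, and, if $k\ge 2$, exactly one of the arcs $(v_0,v_k)$, $(v_k,v_0)$. Then $\mathrm{mader}_{\overrightarrow{\chi}}(F^*)\le \mathrm{mader}_{\overrightarrow{\chi}}(F)+k$.
   Context: All digraphs are finite. $(u,v)$ denotes an arc with tail $u$ and head $v$. An acyclic $k$-coloring of a digraph $D$ is a map $c:V(D)\to\{1,\ldots,k\}$ such that each color class $c^{ -1}(i)$ induces a subdigraph with no directed cycle; the dichromatic number $\overrightarrow{\chi}(D)$ is the least $k$ for which $D$ has an acyclic $k$-coloring. A subdivision of a digraph $H$ is obtained by replacing each arc $(u,v)$ of $H$ by a directed path from $u$ to $v$, these paths being internally vertex-disjoint from each other and from $V(H)$; $D$ contains a subdivision of $H$ if some subdigraph of $D$ is isomorphic to such a subdivision. For a digraph $H$, $\mathrm{mader}_{\overrightarrow{\chi}}(H)$ is the smallest integer $m$ such that every digraph $D$ with $\overrightarrow{\chi}(D)\ge m$ contains a subdivision of $H$ (this is known to be finite). For a graph $G$, $\overleftrightarrow{G}$ (its biorientation) is obtained by replacing each edge $uv$ by the two arcs $(u,v)$ and $(v,u)$; a digon is such a pair of symmetric arcs. For the path $P_k=v_1v_2\ldots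 v_k$, a subdigraph $Q$ of $\overleftrightarrow{P_k}$ is called good if (a) $Q$ is connected (as an underlying graph), $|V(Q)|=k$, and all digons in $Q$ are pairwise vertex-disjoint; and (b) $d^+_Q(v_1)+d^-_Q(v_1)=1$. $\mathscr{S}_k$ denotes the set of good subdigraphs of $\overleftrightarrow{P_k}$. -}

module Defs where

open import Data.Nat using (ℕ; zero; suc; _+_; _<_; _≤_)
open import Data.Fin using (Fin; zero; suc; toℕ; fromℕ; inject₁; splitAt; _≟_)
open import Data.Bool using (Bool; true; false; _∧_; _∨_; if_then_else_)
open import Data.Sum using (_⊎_; inj₁; inj₂)
open import Data.Product using (Σ; ∃; ∃-syntax; _×_; _,_)
open import Data.List using (List; []; _∷_; _++_; map; allFin)
open import Data.Nat.ListAction using (sum)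
open import Data.List.Membership.Propositional using (_∈_; _∉_)
open import Data.List.Relation.Unary.Linked using (Linked)
open import Data.List.Relation.Unary.Unique.Propositional using (Unique)
open import Relation.Binary.PropositionalEquality using (_≡_; _≢_)
open import Relation.Nullary using (¬_)
open import Relation.Nullary.Decidable using (⌊_⌋)
open import Function.Definitions using (Injective)

record Digraph (n : ℕ) : Set where
  field
    arc      : Fin n → Fin n → Bool
    loopless : ∀ v → arc v v ≡ false
open Digraph public

Arc : ∀ {n} → Digraph n → Fin n → Fin n → Set
Arc D u v = arc D u v ≡ true

record DirectedCycleIn {n} (D : Digraph n) (P : Fin n → Set) : Set where
  field
    m      : ℕ
    w      : Fin (suc m) → Fin n
    w-inj  : Injective _≡_ _≡_ w
    w-step : ∀ (i : Fin m) → Arc D (w (inject₁ i)) (w (suc i))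
    w-back : Arc D (w (fromℕ m)) (w zero)
    w-in   : ∀ i → P (w i)

AcyclicColouring : ∀ {n} → Digraph n → (k : ℕ) → (Fin n → Fin k) → Set
AcyclicColouring D k c = ∀ (i : Fin _) → ¬ DirectedCycleIn D (λ v → c v ≡ i)

Colourable : ∀ {n} → Digraph n → ℕ → Set
Colourable D k = Σ (Fin _ → Fin k) (AcyclicColouring D k)

DichromaticAtLeast : ∀ {n} → Digraph n → ℕ → Set
DichromaticAtLeast D m = ∀ k → k < m → ¬ Colourable D k

record DirPath {n} (D : Digraph n) (x y : Fin n) : Set where
  field
    inner  : List (Fin n)
    linked : Linked (Arc D) (x ∷ inner ++ y ∷ [])
    unique : Unique (x ∷ inner ++ y ∷ [])
open DirPath public

record Subdivision {h d} (H : Digraph h) (D : Digraph d) : Set where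
  field
    φ        : Fin h → Fin d
    φ-inj    : Injective _≡_ _≡_ φ
    path     : ∀ a b → Arc H a b → DirPath D (φ a) (φ b)
    avoid    : ∀ a b (e : Arc H a b) c → φ c ∉ inner (path a b e)
    disjoint : ∀ a b (e : Arc H a b) a' b' (e' : Arc H a' b') v →
               v ∈ inner (path a b e) → v ∈ inner (path a' b' e') →
               (a ≡ a') × (b ≡ b')

MaderBound : ∀ {h} → Digraph h → ℕ → Set
MaderBound H m = ∀ d (D : Digraph d) → DichromaticAtLeast D m → Subdivision H D

IsMader : ∀ {h} → Digraph h → ℕ → Set
IsMader H m = MaderBound H m × (∀ m' → m' < m → ¬ MaderBound H m')

-- Good subdigraphs of the biorientation of P_k  (v_i ↔ index i-1)

PathEdge : ∀ {k} → Fin k → Fin k → Set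
PathEdge u v = (toℕ v ≡ suc (toℕ u)) ⊎ (toℕ u ≡ suc (toℕ v))

Adj : ∀ {n} → Digraph n → Fin n → Fin n → Set
Adj D u v = Arc D u v ⊎ Arc D v u

WeaklyConnected : ∀ {n} → Digraph n → Set
WeaklyConnected D = ∀ u v → ∃[ ws ] Linked (Adj D) (u ∷ ws ++ v ∷ [])

Digon : ∀ {n} → Digraph n → Fin n → Fin n → Set
Digon D u v = Arc D u v × Arc D v u

bit : Bool → ℕ
bit true  = 1
bit false = 0

outdeg indeg : ∀ {n} → Digraph n → Fin n → ℕ
outdeg {n} D v = sum (map (λ w → bit (arc D v w)) (allFin n))
indeg  {n} D v = sum (map (λ w → bit (arc D w v)) (allFin n))

first : ∀ {k} → 1 ≤ k → Fin k
first {suc k} _ = zero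

lastV : ∀ {k} → 1 ≤ k → Fin k
lastV {suc k} _ = fromℕ k

record Good (k : ℕ) (hk : 1 ≤ k) (Q : Digraph k) : Set where
  field
    sub       : ∀ u v → Arc Q u v → PathEdge u v
    connected : WeaklyConnected Q
    digons    : ∀ u v u' v' → Digon Q u v → Digon Q u' v' →
                (u ≡ u' ⊎ u ≡ v' ⊎ v ≡ u' ⊎ v ≡ v') →
                ((u ≡ u') × (v ≡ v')) ⊎ ((u ≡ v') × (v ≡ u'))
    deg-v₁    : outdeg Q (first hk) + indeg Q (first hk) ≡ 1

-- F* : vertices Fin (n + k); Fin n ↦ V(F), the rest ↦ v_1,…,v_k.
-- out = true : the extra arc is (v_0 , v_k);  out = false : it is (v_k , v_0).
-- (When k = 1 we have v_k = v_1 and this extra arc is already present,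
--  so the choice is immaterial, matching "if k ≥ 2".)

is : ∀ {n} → Fin n → Fin n → Bool
is a b = ⌊ a ≟ b ⌋

FstarArc : ∀ {n} → Digraph n → Fin n → (k : ℕ) → 1 ≤ k → Digraph k → Bool →
           Fin (n + k) → Fin (n + k) → Bool
FstarArc {n} F v₀ k hk Q out x y with splitAt n x | splitAt n y
... | inj₁ a | inj₁ b = arc F a b
... | inj₂ i | inj₂ j = arc Q i j
... | inj₁ a | inj₂ j = is a v₀ ∧ (is j (first hk) ∨ (out ∧ is j (lastV hk)))
... | inj₂ i | inj₁ b = is b v₀ ∧ (is i (first hk) ∨ (if out then false else is i (lastV hk)))

FstarLoopless : ∀ {n} (F : Digraph n) v₀ k hk Q out x →
                FstarArc F v₀ k hk Q out x x ≡ false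
FstarLoopless {n} F v₀ k hk Q out x with splitAt n x
... | inj₁ a = loopless F a
... | inj₂ i = loopless Q i

Fstar : ∀ {n} → Digraph n → Fin n → (k : ℕ) → 1 ≤ k → Digraph k → Bool →
        Digraph (n + k)
Fstar F v₀ k hk Q out = record
  { arc      = FstarArc F v₀ k hk Q out
  ; loopless = FstarLoopless F v₀ k hk Q out }

{-# OPTIONS --safe #-}

-- Grow a k-coloured set A of vertices greedily.  If a vertex y cannot be added, the claim is
-- that A ∪ {y} contains the whole added part v₀ v₁ … v_k of F*, subdivided, with y as v₀.  Outside
-- A the dichromatic number is still at least m, so a subdivision of F is found there, and its
-- v₀ is such a y.
--
-- For the claim, insert one by one the arcs at y in the direction of the arc between v₀ and v_k.
-- When the arc between y and x makes a k-colouring c fail, c x = c y = 0, say.  Let S start as {x},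
-- and add to S every directed cycle contained in (S ∩ c⁻¹(i)) ∪ (c⁻¹(i + 1) ∖ S), colours
-- modulo k.  If y never enters S, then increasing the colours on S by one is a proper colouring
-- that separates x from y.  Otherwise descend from y to x: from a vertex that entered S with a
-- cycle C, follow C in either direction to a vertex that was in S before, of the preceding
-- colour; the whole of C serves as a digon.  As y has colour 0 at least k steps are available,
-- enough for Q, and from v_k a directed path in S leads on to x.

module Submission where

open import Defs
open import Data.Bool using (Bool; true; false; not; _∧_; _∨_; if_then_else_)
import Data.Bool.Properties as Bool
open import Data.Empty using (⊥; ⊥-elim)
open import Data.Fin using (Fin; zero; suc; toℕ; fromℕ; fromℕ<; inject₁; splitAt; join; _↑ˡ_; _↑ʳ_; _≟_)
open import Data.Fin.Properties using (any?; all?; injective⇒≤; toℕ-fromℕ<; toℕ≤pred[n]; toℕ<n; toℕ-injective; toℕ-inject₁; toℕ-fromℕ; splitAt-↑ˡ; splitAt-↑ʳ; splitAt⁻¹-↑ˡ; splitAt⁻¹-↑ʳ; join-splitAt; splitAt-join)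
open import Data.Fin.Relation.Unary.Top using (view; ‵fromℕ; ‵inject₁)
open import Data.List using (List; []; _∷_; _++_; map; reverse; length; lookup; filter; allFin; tabulate)
open import Data.List.Properties using (unfold-reverse; ++-assoc; ++-identityʳ)
import Data.List.Membership.DecPropositional as DecMembership
open import Data.List.Membership.Propositional using (_∈_; _∉_; find; lose)
open import Data.List.Membership.Propositional.Properties using (∈-++⁻; ∈-++⁺ˡ; ∈-++⁺ʳ; ∈-∃++; ∈-allFin; ∈-tabulate⁺; ∈-tabulate⁻; ∈-lookup; ∈-map⁻; ∈-map⁺; ∈-filter⁺; ∈-filter⁻)
open import Data.List.Relation.Unary.All as All using (All)
import Data.List.Relation.Unary.AllPairs as AllPairs
open import Data.List.Relation.Unary.Any as Any using (here; there)
open import Data.List.Relation.Unary.Any.Properties using (lookup-index)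
open import Data.List.Relation.Unary.Linked using (Linked; [-]) renaming (_∷_ to _∷ᴸ_)
open import Data.List.Relation.Unary.Unique.Propositional using (Unique)
import Data.List.Relation.Unary.Unique.Propositional.Properties as Unique
open import Data.List.Relation.Binary.Permutation.Propositional using (_↭_; ↭-refl; ↭-sym; ↭-trans; ↭⇒↭ₛ; prep)
open import Data.List.Relation.Binary.Permutation.Propositional.Properties using (++-comm; ∈-resp-↭; ↭-reverse; shift) renaming (++⁺ˡ to ↭-++⁺ˡ)
import Data.List.Relation.Binary.Permutation.Setoid.Properties as Permutation
open import Data.Nat using (ℕ; zero; suc; _+_; _≤_; _<_; z≤n; s≤s)
import Data.Nat as ℕ
open import Data.Nat.ListAction using (sum)
import Data.Nat.Properties as ℕ
open import Data.Product using (Σ; ∃; ∃-syntax; _×_; _,_; proj₁; proj₂)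
open import Data.Sum using (_⊎_; inj₁; inj₂; [_,_]′)
import Data.Sum.Properties as Sum
open import Data.Vec using (Vec) renaming ([] to []ᵛ; _∷_ to _∷ᵛ_; lookup to lookupᵛ; tabulate to tabulateᵛ)
open import Data.Vec.Properties using (lookup∘tabulate)
open import Function using (flip; _∘_; id)
open import Relation.Binary.PropositionalEquality using (_≡_; _≢_; refl; sym; trans; cong; cong₂; subst; setoid)
open import Relation.Nullary using (¬_; Dec; yes; no)
open import Relation.Nullary.Decidable using (⌊_⌋; map′; _×-dec_; _⊎-dec_; _→-dec_; ¬?)

-- Paths and simple cycles as lists of vertices.

infixr 5 _∷_

-- The list holds the inner vertices only and at least one step is made, so `Path R a l a` with
-- `a ∷ l` free of repetition is a simple cycle.
data Path {A : Set} (R : A → A → Set) : A → List A → A → Set where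
  [_] : ∀ {a b} → R a b → Path R a [] b
  _∷_ : ∀ {a b c l} → R a b → Path R b l c → Path R a (b ∷ l) c

module _ {A : Set} where

  path-map : ∀ {B : Set} {R : A → A → Set} {T : B → B → Set} {f : A → B} →
             (∀ {a b} → R a b → T (f a) (f b)) →
             ∀ {a l b} → Path R a l b → Path T (f a) (map f l) (f b)
  path-map h [ r ]   = [ h r ]
  path-map h (r ∷ p) = h r ∷ path-map h p

  path-mono : ∀ {R T : A → A → Set} → (∀ {a b} → R a b → T a b) →
              ∀ {a l b} → Path R a l b → Path T a l b
  path-mono h [ r ]   = [ h r ]
  path-mono h (r ∷ p) = h r ∷ path-mono h p

  path-++ : ∀ {R : A → A → Set} {a p b q c} → Path R a p b → Path R b q c → Path R a (p ++ b ∷ q) c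
  path-++ [ r ]   π = r ∷ π
  path-++ (r ∷ ρ) π = r ∷ path-++ ρ π

  path-split : ∀ {R : A → A → Set} {a} p {b q c} → Path R a (p ++ b ∷ q) c → Path R a p b × Path R b q c
  path-split []      (r ∷ π) = [ r ] , π
  path-split (_ ∷ p) (r ∷ π) with path-split p π
  ... | ρ , σ = r ∷ ρ , σ

  path-reverse : ∀ {R : A → A → Set} {a l b} → Path R a l b → Path (flip R) b (reverse l) a
  path-reverse [ r ] = [ r ]
  path-reverse {l = z ∷ l} (r ∷ π) =
    subst (λ l′ → Path _ _ l′ _) (sym (unfold-reverse z l)) (path-++ (path-reverse π) [ r ])

  path-linked : ∀ {R : A → A → Set} {a l b} → Path R a l b → Linked R (a ∷ l ++ b ∷ [])
  path-linked [ r ]   = r ∷ᴸ [-]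
  path-linked (r ∷ π) = r ∷ᴸ path-linked π

  linked-path : ∀ {R : A → A → Set} {a} l {b} → Linked R (a ∷ l ++ b ∷ []) → Path R a l b
  linked-path []      (r ∷ᴸ _) = [ r ]
  linked-path (_ ∷ l) (r ∷ᴸ π) = r ∷ linked-path l π

  ∈-++-∉ : ∀ (xs : List A) {ys v} → v ∈ xs ++ ys → v ∉ ys → v ∈ xs
  ∈-++-∉ xs i v∉ys with ∈-++⁻ xs i
  ... | inj₁ j = j
  ... | inj₂ j = ⊥-elim (v∉ys j)

  unique-resp-↭ : ∀ {xs ys : List A} → xs ↭ ys → Unique xs → Unique ys
  unique-resp-↭ e = Permutation.Unique-resp-↭ (setoid A) (↭⇒↭ₛ e)

  ∉-all : ∀ {x : A} {xs} → x ∉ xs → All.All (x ≢_) xs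
  ∉-all x∉ = All.tabulate (λ i e → x∉ (subst (_∈ _) (sym e) i))

  unique-∷ : ∀ {x : A} {xs} → x ∉ xs → Unique xs → Unique (x ∷ xs)
  unique-∷ x∉ u = ∉-all x∉ AllPairs.∷ u

  unique-head : ∀ {x : A} {xs} → Unique (x ∷ xs) → x ∉ xs
  unique-head (a AllPairs.∷ _) i = All.lookup a i refl

  unique-++ˡ : ∀ (xs : List A) {ys} → Unique (xs ++ ys) → Unique xs
  unique-++ˡ []       _ = AllPairs.[]
  unique-++ˡ (x ∷ xs) u@(_ AllPairs.∷ v) = unique-∷ (unique-head u ∘ ∈-++⁺ˡ) (unique-++ˡ xs v)

  unique-++ʳ : ∀ (xs : List A) {ys} → Unique (xs ++ ys) → Unique ys
  unique-++ʳ []       u = u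
  unique-++ʳ (x ∷ xs) (_ AllPairs.∷ v) = unique-++ʳ xs v

  unique-disjoint : ∀ (xs : List A) {ys} → Unique (xs ++ ys) → ∀ {v} → v ∈ xs → v ∉ ys
  unique-disjoint (x ∷ xs) u (here refl) j = unique-head u (∈-++⁺ʳ xs j)
  unique-disjoint (x ∷ xs) (_ AllPairs.∷ u) (there i) j = unique-disjoint xs u i j

  -- C lists the vertices of a simple cycle; the constructor only fixes a starting point.
  record Cycle (R : A → A → Set) (C : List A) : Set where
    field
      base    : A
      rest    : List A
      closed  : Path R base rest base
      unique  : Unique (base ∷ rest)
      covers  : base ∷ rest ↭ C

  rotate : ∀ {R C} → Cycle R C → ∀ {a} → a ∈ C →
           ∃[ l ] Path R a l a × Unique (a ∷ l) × a ∷ l ↭ C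
  rotate C a∈C with ∈-resp-↭ (↭-sym (Cycle.covers C)) a∈C
  ... | here refl = Cycle.rest C , Cycle.closed C , Cycle.unique C , Cycle.covers C
  ... | there i with ∈-∃++ i
  ...   | p , q , e = q ++ Cycle.base C ∷ p , path-++ (proj₂ s) (proj₁ s) ,
                      unique-resp-↭ π (Cycle.unique C) , ↭-trans (↭-sym π) (Cycle.covers C)
    where
      s = path-split p (subst (λ l → Path _ _ l _) e (Cycle.closed C))
      π : Cycle.base C ∷ Cycle.rest C ↭ _ ∷ q ++ Cycle.base C ∷ p
      π = subst (λ l → Cycle.base C ∷ l ↭ _) (sym e) (++-comm (Cycle.base C ∷ p) _)

  -- The cycle is rotated to start at `a` and then cut at `b`. The two paths serve as the two sides
  -- of a digon, or as the two ways from `a` to `b`.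
  arcs : ∀ {R C} → Cycle R C → ∀ {a b} → a ∈ C → b ∈ C → a ≢ b →
         ∃[ l ] ∃[ l′ ] Path R a l b × Path R b l′ a × Unique (a ∷ l ++ b ∷ l′) × (a ∷ l ++ b ∷ l′ ↭ C)
  arcs C a∈C b∈C a≢b with rotate C a∈C
  ... | l , π , u , e with ∈-resp-↭ (↭-sym e) b∈C
  ...   | here b≡a = ⊥-elim (a≢b (sym b≡a))
  ...   | there i with ∈-∃++ i
  ...     | p , q , refl = p , q , proj₁ (path-split p π) , proj₂ (path-split p π) , u , e

-- Directed cycles in a finite digraph.

module _ {n : ℕ} where

  private V = Fin n

  successor : ∀ {D : Digraph n} {P} (C : DirectedCycleIn D P) i → ∃[ j ] Arc D (DirectedCycleIn.w C i) (DirectedCycleIn.w C j)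
  successor C i with view i
  ... | ‵fromℕ    = zero , DirectedCycleIn.w-back C
  ... | ‵inject₁ j = suc j , DirectedCycleIn.w-step C j

  predecessor : ∀ {D : Digraph n} {P} (C : DirectedCycleIn D P) i → ∃[ j ] Arc D (DirectedCycleIn.w C j) (DirectedCycleIn.w C i)
  predecessor C zero    = _ , DirectedCycleIn.w-back C
  predecessor C (suc i) = _ , DirectedCycleIn.w-step C i

  cycle-map : ∀ {D E : Digraph n} {P Q : V → Set} →
              (C : DirectedCycleIn D P) →
              (∀ i → Q (DirectedCycleIn.w C i)) →
              (∀ i j → Arc D (DirectedCycleIn.w C i) (DirectedCycleIn.w C j) → Arc E (DirectedCycleIn.w C i) (DirectedCycleIn.w C j)) →
              DirectedCycleIn E Q
  cycle-map C q h = record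
    { m = m ; w = w ; w-inj = w-inj ; w-step = λ i → h _ _ (w-step i) ; w-back = h _ _ w-back ; w-in = q }
    where open DirectedCycleIn C

  tabulate-path : ∀ {R : V → V → Set} m (w : Fin (suc m) → V) {b} →
                  (∀ (i : Fin m) → R (w (inject₁ i)) (w (suc i))) → R (w (fromℕ m)) b →
                  Path R (w zero) (tabulate (w ∘ suc)) b
  tabulate-path zero    w s r = [ r ]
  tabulate-path (suc m) w s r = s zero ∷ tabulate-path m (w ∘ suc) (s ∘ suc) r

  listing : ∀ {D : Digraph n} {P} → DirectedCycleIn D P → List V
  listing C = tabulate (DirectedCycleIn.w C)

  listing-cycle : ∀ {D : Digraph n} {P} (C : DirectedCycleIn D P) → Cycle (Arc D) (listing C)
  listing-cycle C = record
    { closed = tabulate-path m w w-step w-back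
    ; unique = Unique.tabulate⁺ w-inj
    ; covers = ↭-refl }
    where
      open DirectedCycleIn C

  listing-in : ∀ {D : Digraph n} {P} (C : DirectedCycleIn D P) {v} → v ∈ listing C → P v
  listing-in {P = P} C i with ∈-tabulate⁻ i
  ... | j , e = subst P (sym e) (DirectedCycleIn.w-in C j)

  any-vec? : ∀ m {P : Vec V m → Set} → (∀ v → Dec (P v)) → Dec (∃ P)
  any-vec? zero    P? = map′ (λ p → []ᵛ , p) (λ { ([]ᵛ , p) → p }) (P? []ᵛ)
  any-vec? (suc m) P? = map′ (λ { (a , v , p) → a ∷ᵛ v , p }) (λ { (a ∷ᵛ v , p) → a , v , p })
                             (any? (λ a → any-vec? m (λ v → P? (a ∷ᵛ v))))

  IsCycle : Digraph n → (V → Set) → ∀ m → (Fin (suc m) → V) → Set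
  IsCycle D P m w = (∀ i j → w i ≡ w j → i ≡ j) × (∀ (i : Fin m) → Arc D (w (inject₁ i)) (w (suc i)))
                    × Arc D (w (fromℕ m)) (w zero) × (∀ i → P (w i))

  -- The search below runs over vectors, and tabulating a function gives it back only pointwise.
  isCycle-resp : ∀ D P {m w w′} → (∀ i → w i ≡ w′ i) → IsCycle D P m w → IsCycle D P m w′
  isCycle-resp D P e (i , s , b , p) =
    (λ a c h → i a c (trans (e a) (trans h (sym (e c))))) ,
    (λ a → arc-resp (e _) (e _) (s a)) , arc-resp (e _) (e _) b , (λ a → subst P (e a) (p a))
    where
      arc-resp : ∀ {a a′ c c′} → a ≡ a′ → c ≡ c′ → Arc D a c → Arc D a′ c′
      arc-resp refl refl r = r

  -- Injectivity of `w` bounds the number of vertices by `n`, so finitely many vectors have to be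
  -- tried.
  cycle? : ∀ (D : Digraph n) {P} → (∀ v → Dec (P v)) → Dec (DirectedCycleIn D P)
  cycle? D {P} P? = map′ to from (any? λ (m : Fin n) → any-vec? (suc (toℕ m)) λ v → isCycle? (toℕ m) (lookupᵛ v))
    where
      isCycle? : ∀ m w → Dec (IsCycle D P m w)
      isCycle? m w = all? (λ i → all? λ j → (w i ≟ w j) →-dec (i ≟ j))
        ×-dec all? (λ i → arc D _ _ Bool.≟ true) ×-dec (arc D _ _ Bool.≟ true) ×-dec all? (P? ∘ w)
      to : (∃ λ (m : Fin n) → ∃ λ v → IsCycle D P (toℕ m) (lookupᵛ v)) → DirectedCycleIn D P
      to (m , v , i , s , b , p) = record
        { m = toℕ m ; w = lookupᵛ v ; w-inj = λ {a} {c} → i a c ; w-step = s ; w-back = b ; w-in = p }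
      from : DirectedCycleIn D P → ∃ λ (m : Fin n) → ∃ λ v → IsCycle D P (toℕ m) (lookupᵛ v)
      from C = fromℕ< m<n ,
        subst (λ m → ∃ λ v → IsCycle D P m (lookupᵛ v)) (sym (toℕ-fromℕ< m<n))
          (tabulateᵛ w , isCycle-resp D P (sym ∘ lookup∘tabulate w) ((λ i j → w-inj) , w-step , w-back , w-in))
        where
          open DirectedCycleIn C
          m<n : m < n
          m<n = injective⇒≤ w-inj

-- Leaving a set for the old vertices.

module _ {A : Set} {R : A → A → Set} {Old U : A → Set}
         (Old? : ∀ v → Dec (Old v)) (U? : ∀ v → Dec (U v)) where

  -- The alternative `from ≡ a` serves the recursion: on a suffix whose first vertex lies outside
  -- `U`, it signals that the exit must be extended backwards.
  record Exit (a : A) (l : List A) (b : A) : Set where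
    field
      from to  : A
      via    : List A
      from-ok  : from ≡ a ⊎ U from
      to-old   : Old to
      path     : Path R from via to
      clean    : ∀ {v} → v ∈ via → ¬ Old v × ¬ U v
      distinct   : Unique (from ∷ via)
      from-in  : from ∈ a ∷ l
      via-in : ∀ {v} → v ∈ via → v ∈ l
      to-in    : to ∈ l ++ b ∷ []

  -- U may be met several times on the way to the first old vertex; the exit starts at the last one.
  exit : ∀ {a l b} → Path R a l b → Old b → Unique (a ∷ l) → Exit a l b
  exit {a} {b = b} [ r ] ob u = record
    { from = a ; to = b ; via = [] ; from-ok = inj₁ refl ; to-old = ob ; path = [ r ]
    ; clean = λ () ; distinct = u ; from-in = here refl ; via-in = λ () ; to-in = here refl }
  exit {a} {z ∷ l} {b} (r ∷ π) ob u@(_ AllPairs.∷ u′) with Old? z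
  ... | yes oz = record
    { from = a ; to = z ; via = [] ; from-ok = inj₁ refl ; to-old = oz ; path = [ r ]
    ; clean = λ () ; distinct = All.[] AllPairs.∷ AllPairs.[] ; from-in = here refl
    ; via-in = λ () ; to-in = here refl }
  ... | no ¬oz with exit π ob u′ | U? z
  ...   | e | yes uz = record
    { from = from ; to = to ; via = via ; from-ok = inj₂ ([ (λ eq → subst U (sym eq) uz) , id ]′ from-ok)
    ; to-old = to-old ; path = path ; clean = clean ; distinct = distinct ; from-in = there from-in
    ; via-in = there ∘ via-in ; to-in = there to-in }
    where open Exit e
  ...   | e | no ¬uz with Exit.from-ok e
  ...     | inj₂ uf = record
    { from = from ; to = to ; via = via ; from-ok = inj₂ uf
    ; to-old = to-old ; path = path ; clean = clean ; distinct = distinct ; from-in = there from-in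
    ; via-in = there ∘ via-in ; to-in = there to-in }
    where open Exit e
  ...     | inj₁ refl = record
    { from = a ; to = to ; via = z ∷ via ; from-ok = inj₁ refl
    ; to-old = to-old ; path = r ∷ path
    ; clean = λ { (here refl) → ¬oz , ¬uz ; (there i) → clean i }
    ; distinct = unique-∷ (λ { (here refl) → unique-head u (here refl)
                           ; (there i) → unique-head u (there (via-in i)) }) distinct
    ; from-in = here refl
    ; via-in = λ { (here refl) → here refl ; (there i) → there (via-in i) }
    ; to-in = there to-in }
    where open Exit e

-- Directions of arcs, and chains of links.

Directed : ∀ {A : Set} → (A → A → Set) → Bool → A → A → Set
Directed R true  = R
Directed R false = flip R

Double : (Bool → Bool) → Set
Double p = p true ≡ true × p false ≡ true

double? : ∀ p → Dec (Double p)
double? p = (p true Bool.≟ true) ×-dec (p false Bool.≟ true)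

-- A step that requires neither direction receives one too, since the descent has to follow some
-- path.
one-direction : ∀ p → ¬ Double p → ∃[ δ ] (∀ δ′ → p δ′ ≡ true → δ′ ≡ δ)
one-direction p ¬d with p true in e | p false in f
... | true  | true  = ⊥-elim (¬d (refl , refl))
... | true  | false = true  , λ { true _ → refl ; false q → ⊥-elim (Bool.not-¬ f q) }
... | false | _     = false , λ { false _ → refl ; true q → ⊥-elim (Bool.not-¬ e q) }

single : ∀ {A : Set} → Bool → List A → Bool → List A
single true  l true  = l
single true  l false = []
single false l true  = []
single false l false = l

single-self : ∀ {A : Set} δ (l : List A) → single δ l δ ≡ l
single-self true  l = refl
single-self false l = refl

single-++ : ∀ {A : Set} δ (l : List A) → single δ l true ++ single δ l false ≡ l
single-++ true  l = ++-identityʳ l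
single-++ false l = refl

-- The vertices v₀ … v_N with the inner vertices of the paths between consecutive ones, and of the
-- path from v_N back to y.  Direction false reads arcs backwards, so every link is listed from
-- node i towards node (i + 1).  A pattern tells which directions are required at each step.
record Chain {A : Set} (R : A → A → Set) (y : A) (P : A → Set) (N : ℕ) (pat : ℕ → Bool → Bool) (v : A) : Set where
  field
    node : ℕ → A
    link : ℕ → Bool → List A
    start   : node 0 ≡ v
    joined  : ∀ i → i < N → ∀ δ → pat i δ ≡ true → Path (Directed R δ) (node i) (link i δ) (node (suc i))
    closing : ∀ δ → pat N δ ≡ true → Path (Directed R δ) (node N) (link N δ) y
  block : ℕ → List A
  block i = node i ∷ link i true ++ link i false
  field
    block-unique   : ∀ i → i ≤ N → Unique (block i)
    block-disjoint : ∀ i j → i ≤ N → j ≤ N → ∀ {w} → w ∈ block i → w ∈ block j → i ≡ j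
    block-in       : ∀ i → i ≤ N → ∀ {w} → w ∈ block i → P w

module _ {A : Set} {R : A → A → Set} {y : A} where

  chain-mono : ∀ {P P′ : A → Set} {N pat v} → (∀ {w} → P w → P′ w) → Chain R y P N pat v → Chain R y P′ N pat v
  chain-mono h ch = record
    { node = node ; link = link ; start = start ; joined = joined ; closing = closing
    ; block-unique = block-unique ; block-disjoint = block-disjoint
    ; block-in = λ i i≤ j → h (block-in i i≤ j) }
    where open Chain ch

  chain-closing : ∀ {P : A → Set} {pat v} (link₀ : Bool → List A) →
    (∀ δ → pat 0 δ ≡ true → Path (Directed R δ) v (link₀ δ) y) →
    Unique (v ∷ link₀ true ++ link₀ false) →
    (∀ {w} → w ∈ v ∷ link₀ true ++ link₀ false → P w) →
    Chain R y P 0 pat v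
  chain-closing {v = v} link₀ π u h = record
    { node = λ _ → v ; link = λ _ → link₀ ; start = refl ; joined = λ _ () ; closing = π
    ; block-unique = λ _ _ → u ; block-disjoint = λ { zero zero _ _ _ _ → refl }
    ; block-in = λ _ _ → h }

  chain-∷ : ∀ {P Q : A → Set} {N pat v u} (link₀ : Bool → List A) →
    (∀ δ → pat 0 δ ≡ true → Path (Directed R δ) v (link₀ δ) u) →
    Unique (v ∷ link₀ true ++ link₀ false) →
    (∀ {w} → w ∈ v ∷ link₀ true ++ link₀ false → P w) →
    (∀ {w} → Q w → P w) →
    (ch : Chain R y Q N (pat ∘ suc) u) →
    (∀ {w} → w ∈ v ∷ link₀ true ++ link₀ false → ∀ i → i ≤ N → w ∉ Chain.block ch i) →
    Chain R y P (suc N) pat v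
  chain-∷ {v = v} link₀ π u h q ch d = record
    { node = λ { zero → v ; (suc i) → node i }
    ; link = λ { zero → link₀ ; (suc i) → link i }
    ; start = refl
    ; joined = λ { zero _ δ e → subst (Path _ _ _) (sym start) (π δ e) ; (suc i) (s≤s i<) → joined i i< }
    ; closing = closing
    ; block-unique = λ { zero _ → u ; (suc i) (s≤s i≤) → block-unique i i≤ }
    ; block-disjoint = λ { zero zero _ _ _ _ → refl
                         ; zero (suc j) _ (s≤s j≤) a b → ⊥-elim (d a j j≤ b)
                         ; (suc i) zero (s≤s i≤) _ a b → ⊥-elim (d b i i≤ a)
                         ; (suc i) (suc j) (s≤s i≤) (s≤s j≤) a b → cong suc (block-disjoint i j i≤ j≤ a b) }
    ; block-in = λ { zero _ → h ; (suc i) (s≤s i≤) → q ∘ block-in i i≤ } }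
    where open Chain ch

-- Growing S by cycles and descending from y to x.

module Growth {n : ℕ} (G : Digraph n) (R : Fin n → Fin n → Set) (G⊆R : ∀ {u v} → Arc G u v → R u v)
              (c : Fin n → ℕ) (K : ℕ) (x y : Fin n) (cx : c x ≡ 0)
              (δ₀ : Bool) (close : Directed R δ₀ x y) where

  private V = Fin n
  open DecMembership (_≟_ {n}) using (_∈?_)

  next : ℕ → ℕ
  next i with i ℕ.≟ K
  ... | yes _ = 0
  ... | no  _ = suc i

  next-0 : ∀ i → next i ≡ 0 → i ≡ K
  next-0 i e with i ℕ.≟ K
  next-0 i e  | yes p = p
  next-0 i () | no  _

  next-suc : ∀ i j → next i ≡ suc j → i ≡ j
  next-suc i j e with i ℕ.≟ K
  next-suc i j () | yes p
  next-suc i j e  | no  _ = ℕ.suc-injective e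

  -- Colours run over 0, …, K, so that k = K + 1.
  data Stage (S : List V) (i : ℕ) (v : V) : Set where
    old : v ∈ S → c v ≡ i → Stage S i v
    new : v ∉ S → c v ≡ next i → Stage S i v

  stage? : ∀ S i v → Dec (Stage S i v)
  stage? S i v = map′ [ (λ (a , b) → old a b) , (λ (a , b) → new a b) ]′
                      (λ { (old a b) → inj₁ (a , b) ; (new a b) → inj₂ (a , b) })
                      ((v ∈? S ×-dec (c v ℕ.≟ i)) ⊎-dec (¬? (v ∈? S) ×-dec (c v ℕ.≟ next i)))

  -- The order of insertion makes every descent a structural recursion. In `C` the members of `S`
  -- have colour `i` and the others `next i`, so a passage from new to old lowers the colour by one
  -- modulo `suc K`. Repetitions in the list are harmless, as only membership counts.
  data History : List V → Set where
    init : History (x ∷ [])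
    grow : ∀ {S} → History S → ∀ i {C} → Cycle (Arc G) C → (∀ {v} → v ∈ C → Stage S i v) →
           ∀ {u} → u ∈ C → u ∈ S → History (C ++ S)

  module _ {S : List V} {U : V → Set} (U? : ∀ v → Dec (U v)) where

    -- The two arcs of `C` between `v` and `u` give one route for each direction, the second read
    -- backwards. `exit` then trims the route at both ends.
    leave : ∀ {C} → Cycle (Arc G) C → ∀ {u} → u ∈ C → u ∈ S → ∀ {v} → v ∈ C → v ∉ S → U v → ∀ δ →
            ∃[ a ] ∃[ l ] ∃[ b ] U a × b ∈ S × Path (Directed R δ) a l b ×
            (∀ {w} → w ∈ l → w ∉ S × ¬ U w) × Unique (a ∷ l) × a ∈ C × (∀ {w} → w ∈ l → w ∈ C) × b ∈ C
    leave C {u} u∈C u∈S {v} v∈C v∉S Uv δ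
      with arcs C v∈C u∈C (λ { refl → v∉S u∈S })
    ... | l , l′ , π , π′ , uq , e = from , via , to ,
          [ (λ e → subst U (sym e) Uv) , id ]′ from-ok , to-old , path , clean , distinct ,
          ∈-resp-↭ e (sub δ from-in) , ∈-resp-↭ e ∘ sub δ ∘ there ∘ via-in ,
          ∈-resp-↭ e (sub′ δ to-in)
      where
        route : Bool → List V
        route true  = l
        route false = reverse l′
        walk : ∀ δ → Path (Directed R δ) v (route δ) u
        walk true  = path-mono G⊆R π
        walk false = path-mono G⊆R (path-reverse π′)
        back : ∀ {w} → w ∈ reverse l′ → w ∈ l′
        back = ∈-resp-↭ (↭-reverse l′)
        simple : ∀ δ → Unique (v ∷ route δ)
        simple true  = unique-++ˡ (v ∷ l) uq
        simple false = unique-∷ (λ i → unique-head uq (∈-++⁺ʳ l (there (back i))))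
                         (unique-resp-↭ (↭-sym (↭-reverse l′)) (unique-++ʳ (v ∷ l ++ u ∷ []) (subst Unique (sym (++-assoc (v ∷ l) (u ∷ []) l′)) uq)))
        sub : ∀ δ {w} → w ∈ v ∷ route δ → w ∈ v ∷ l ++ u ∷ l′
        sub true  i           = ∈-++⁺ˡ i
        sub false (here refl) = here refl
        sub false (there i)   = ∈-++⁺ʳ (v ∷ l) (there (back i))
        sub′ : ∀ δ {w} → w ∈ route δ ++ u ∷ [] → w ∈ v ∷ l ++ u ∷ l′
        sub′ δ i with ∈-++⁻ (route δ) i
        ... | inj₁ j           = sub δ (there j)
        ... | inj₂ (here refl) = ∈-++⁺ʳ (v ∷ l) (here refl)
        open Exit (exit {R = Directed R δ} {Old = _∈ S} {U = U} (λ w → w ∈? S) U? (walk δ) u∈S (simple δ))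

  -- If `U` meets the older set, the path is found there. Otherwise the newest cycle is left in
  -- direction `δ₀`, and the rest runs in the older set, which `U` misses. At the bottom only `x`
  -- remains, and `close` leads to `y`.
  tail : ∀ {S} → History S → ∀ {U : V → Set} (U? : ∀ v → Dec (U v)) → ∀ {v} → v ∈ S → U v →
         ∃[ a ] ∃[ l ] U a × Path (Directed R δ₀) a l y × Unique (a ∷ l) × (∀ {w} → w ∈ a ∷ l → w ∈ S) × (∀ {w} → w ∈ l → ¬ U w)
  tail init U? (here refl) Uv = x , [] , Uv , [ close ] , All.[] AllPairs.∷ AllPairs.[] , id , λ ()
  tail (grow {S} h i {C} cyc st u∈C u∈S) {U} U? {v} v∈ Uv with Any.any? U? S
  ... | yes p with tail h U? (proj₁ (proj₂ (find p))) (proj₂ (proj₂ (find p)))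
  ...   | a , l , Ua , π , uq , inS , cl = a , l , Ua , π , uq , ∈-++⁺ʳ C ∘ inS , cl
  tail (grow {S} h i {C} cyc st u∈C u∈S) {U} U? {v} v∈ Uv | no ¬p
    with leave U? cyc u∈C u∈S (∈-++-∉ C v∈ v∉S) v∉S Uv δ₀
    where
      v∉S : v ∉ S
      v∉S j = ¬p (lose j Uv)
  ... | a , l , b , Ua , b∈S , π , cl , uq , a∈C , l⊆C , b∈C
    -- A singleton in place of `U` forces the remaining path to start at `b`.
    with tail h (_≟ b) b∈S refl
  ...   | _ , t , refl , ρ , uq′ , inS , cl′ =
    a , l ++ b ∷ t , Ua , path-++ π ρ ,
    Unique.++⁺ uq uq′ (λ { (here refl , j) → ¬p (lose (inS j) Ua) ; (there i , j) → proj₁ (cl i) (inS j) }) ,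
    (λ { (here refl) → ∈-++⁺ˡ a∈C ; (there j) → [ ∈-++⁺ˡ ∘ l⊆C , ∈-++⁺ʳ C ∘ inS ]′ (∈-++⁻ l j) }) ,
    (λ j → [ proj₂ ∘ cl , (λ r Uw → ¬p (lose (inS r) Uw)) ]′ (∈-++⁻ l j))

  Sparse : (ℕ → Bool → Bool) → Set
  Sparse pat = ∀ i → Double (pat i) → ¬ Double (pat (suc i))

  Ends : ℕ → (ℕ → Bool → Bool) → Set
  Ends N pat = ∀ δ → pat N δ ≡ true → δ ≡ δ₀

  ends-single : ∀ pat → Ends 0 pat → ¬ Double (pat 0)
  ends-single pat e (p , q) with e true p | e false q
  ... | refl | ()

  -- Meeting `U` at the start only is what keeps a chain off a cycle whose old part is `U`, so that
  -- the whole cycle can form a digon.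
  Chosen : List V → ℕ → (ℕ → Bool → Bool) → (V → Set) → Set
  Chosen S N pat U = ∃[ u ] U u × Σ (Chain R y (_∈ S) N pat u) λ ch →
                     ∀ i → i ≤ N → ∀ {w} → w ∈ Chain.block ch i → U w → w ≡ u

  chosen-mono : ∀ {S S′ N pat U} → (∀ {w} → w ∈ S → w ∈ S′) → Chosen S N pat U → Chosen S′ N pat U
  chosen-mono h (u , Uu , ch , d) = u , Uu , chain-mono h ch , d

  -- After a digon on a cycle C, the descent goes on from a vertex of U = C ∩ S, and the choice of
  -- this vertex must keep it away from the rest of C.  It is the vertex of U which entered S first;
  -- among those that entered with the same cycle, it is the last one met before leaving that
  -- cycle in the direction of the next step, which is determined because digons are disjoint.
  chain-from-set : ∀ {S} → History S → ∀ N pat → Ends N pat → Sparse pat → ¬ Double (pat 0) →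
                   ∀ {U : V → Set} (U? : ∀ v → Dec (U v)) → (∀ {w} → U w → c w ≡ N) →
                   ∀ {v} → v ∈ S → U v → Chosen S N pat U
  -- Here the first step may be a digon, made of the cycle with which `v` entered; `x` entered
  -- without one. The colour condition goes through `next` so as to cover both `c v ≡ suc N` and the
  -- wrap-around at `y`, where `c v ≡ 0` and `N` is `K`.
  chain-from-vertex : ∀ {S} → History S → ∀ N pat → Ends (suc N) pat → Sparse pat → ¬ Double (pat 1) →
                      ∀ {v} → v ∈ S → v ≢ x → (∀ i → next i ≡ c v → i ≡ N) →
                      Chain R y (_∈ S) (suc N) pat v

  chain-from-set h zero pat ends _ _ {U} U? _ v∈ Uv with tail h U? v∈ Uv
  ... | a , l , Ua , π , uq , inS , cl =
    a , Ua , chain-closing (single δ₀ l) closes (subst (Unique ∘ (a ∷_)) (sym (single-++ δ₀ l)) uq) (inS ∘ toL) ,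
    λ { zero _ i → avoids (toL i) }
    where
      closes : ∀ δ → pat 0 δ ≡ true → Path (Directed R δ) a (single δ₀ l δ) y
      closes δ e with ends δ e
      ... | refl = subst (λ l → Path _ _ l _) (sym (single-self δ₀ l)) π
      toL : ∀ {w} → w ∈ a ∷ single δ₀ l true ++ single δ₀ l false → w ∈ a ∷ l
      toL = subst (λ l → _ ∈ a ∷ l) (single-++ δ₀ l)
      avoids : ∀ {w} → w ∈ a ∷ l → U w → w ≡ a
      avoids (here e)  _ = e
      avoids (there i) p = ⊥-elim (cl i p)
  chain-from-set init (suc N) pat _ _ _ U? col (here refl) Uv with trans (sym cx) (col Uv)
  ... | ()
  chain-from-set (grow {S} h i {C} cyc st u∈C u∈S) (suc N) pat ends sp nd {U} U? col {v} v∈ Uv with Any.any? U? S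
  ... | yes p = chosen-mono (∈-++⁺ʳ C)
                  (chain-from-set h (suc N) pat ends sp nd U? col (proj₁ (proj₂ (find p))) (proj₂ (proj₂ (find p))))
  ... | no ¬p
    with one-direction (pat 0) nd
  ... | δ , only
    with leave U? cyc u∈C u∈S (∈-++-∉ C v∈ v∉S) v∉S Uv δ
    where
      v∉S : v ∉ S
      v∉S j = ¬p (lose j Uv)
  ... | a , l , b , Ua , b∈S , π , cl , uq , a∈C , l⊆C , b∈C =
    a , Ua ,
    chain-∷ (single δ l) goes (subst (Unique ∘ (a ∷_)) (sym (single-++ δ l)) uq)
      (λ j → ∈-++⁺ˡ (inC (toL j))) (∈-++⁺ʳ C) onward
      (λ j i i≤ r → notS (toL j) (Chain.block-in onward i i≤ r)) ,
    λ { zero _ j → avoids (toL j) ; (suc i) (s≤s i≤) r Uw → ⊥-elim (¬p (lose (Chain.block-in onward i i≤ r) Uw)) }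
    where
      goes : ∀ δ′ → pat 0 δ′ ≡ true → Path (Directed R δ′) a (single δ l δ′) b
      goes δ′ e with only δ′ e
      ... | refl = subst (λ l → Path _ _ l _) (sym (single-self δ l)) π
      toL : ∀ {w} → w ∈ a ∷ single δ l true ++ single δ l false → w ∈ a ∷ l
      toL = subst (λ l → _ ∈ a ∷ l) (single-++ δ l)
      inC : ∀ {w} → w ∈ a ∷ l → w ∈ C
      inC (here refl) = a∈C
      inC (there j)   = l⊆C j
      notS : ∀ {w} → w ∈ a ∷ l → w ∉ S
      notS (here refl) r = ¬p (lose r Ua)
      notS (there j)     = proj₁ (cl j)
      avoids : ∀ {w} → w ∈ a ∷ l → U w → w ≡ a
      avoids (here e)  _ = e
      avoids (there i) p = ⊥-elim (proj₂ (cl i) p)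
      i≡N : i ≡ N
      i≡N with st a∈C
      ... | old r _ = ⊥-elim (notS (here refl) r)
      ... | new _ e = next-suc i N (trans (sym e) (col Ua))
      cb : c b ≡ N
      cb with st b∈C
      ... | old _ e = trans e i≡N
      ... | new r _ = ⊥-elim (r b∈S)
      -- If the next step is a digon, the chain goes on along the cycle with which `b` entered; a
      -- positive colour makes `b` differ from `x`. Otherwise the singleton of `b` is the set to
      -- start from.
      continue : ∀ N → c b ≡ N → Ends N (pat ∘ suc) → Chain R y (_∈ S) N (pat ∘ suc) b
      continue zero cb ends with chain-from-set h zero (pat ∘ suc) ends (sp ∘ suc) (ends-single (pat ∘ suc) ends) (_≟ b) (λ { refl → cb }) b∈S refl
      ... | _ , refl , ch , _ = ch
      continue (suc N) cb ends with double? (pat 1)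
      ... | yes d = chain-from-vertex h N (pat ∘ suc) ends (sp ∘ suc) (sp 1 d) b∈S
                      (λ { refl → ℕ.0≢1+n (trans (sym cx) cb) }) (λ i e → next-suc i N (trans e cb))
      ... | no ¬d with chain-from-set h (suc N) (pat ∘ suc) ends (sp ∘ suc) ¬d (_≟ b) (λ { refl → cb }) b∈S refl
      ...   | _ , refl , ch , _ = ch
      onward = continue N cb ends

  chain-from-vertex init N pat _ _ _ (here refl) v≢x _ = ⊥-elim (v≢x refl)
  chain-from-vertex (grow {S} h i {C} cyc st {u} u∈C u∈S) N pat ends sp nd {v} v∈ v≢x col with v ∈? S
  ... | yes v∈S = chain-mono (∈-++⁺ʳ C) (chain-from-vertex h N pat ends sp nd v∈S v≢x col)
  ... | no v∉S = extend
    -- All of `C ∩ S` is offered, so the chain obtained meets `C` in its first vertex alone.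
    (chain-from-set h N (pat ∘ suc) ends (sp ∘ suc) nd (λ w → (w ∈? C) ×-dec (w ∈? S)) colour u∈S (u∈C , u∈S))
    where
      v∈C : v ∈ C
      v∈C = ∈-++-∉ C v∈ v∉S
      i≡N : i ≡ N
      i≡N with st v∈C
      ... | old r _ = ⊥-elim (v∉S r)
      ... | new _ e = col i (sym e)
      colour : ∀ {w} → w ∈ C × w ∈ S → c w ≡ N
      colour (a , b) with st a
      ... | old _ e = trans e i≡N
      ... | new r _ = ⊥-elim (r b)
      extend : Chosen S N (pat ∘ suc) (λ w → w ∈ C × w ∈ S) → Chain R y (_∈ C ++ S) (suc N) pat v
      extend (a , (a∈C , a∈S) , ch , sep) with arcs cyc v∈C a∈C (λ { refl → v∉S a∈S })
      ... | l , l′ , π , π′ , uq , e =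
        chain-∷ both goes (proj₂ uq-sep) (∈-++⁺ˡ ∘ inC) (∈-++⁺ʳ C) ch
          -- A common vertex would lie in `C ∩ S`, hence equal `a`, which the new block omits.
          (λ j i i≤ r → proj₁ uq-sep (subst (_∈ _) (sep i i≤ r (inC j , Chain.block-in ch i i≤ r)) j))
        where
          both : Bool → List V
          both true  = l
          both false = reverse l′
          goes : ∀ δ → pat 0 δ ≡ true → Path (Directed R δ) v (both δ) a
          goes true  _ = path-mono G⊆R π
          goes false _ = path-mono G⊆R (path-reverse π′)
          rearranged : v ∷ l ++ a ∷ l′ ↭ a ∷ v ∷ l ++ reverse l′
          rearranged = ↭-trans (shift a (v ∷ l) l′) (prep a (prep v (↭-++⁺ˡ l (↭-sym (↭-reverse l′)))))
          uq-sep : a ∉ v ∷ l ++ reverse l′ × Unique (v ∷ l ++ reverse l′)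
          uq-sep = unique-head (unique-resp-↭ rearranged uq) , unique-++ʳ (a ∷ []) (unique-resp-↭ rearranged uq)
          inC : ∀ {w} → w ∈ v ∷ l ++ reverse l′ → w ∈ C
          inC j = ∈-resp-↭ e (∈-resp-↭ (↭-sym rearranged) (there j))

-- Monochromatic cycles, saturation and the shifted colouring.

lookup-injective : ∀ {A : Set} {xs : List A} → Unique xs → ∀ i j → lookup xs i ≡ lookup xs j → i ≡ j
lookup-injective {xs = _ ∷ _} _ zero    zero    _ = refl
lookup-injective {xs = _ ∷ _} u zero    (suc j) e = ⊥-elim (unique-head u (subst (_∈ _) (sym e) (∈-lookup j)))
lookup-injective {xs = _ ∷ _} u (suc i) zero    e = ⊥-elim (unique-head u (subst (_∈ _) e (∈-lookup i)))
lookup-injective {xs = _ ∷ _} (_ AllPairs.∷ u) (suc i) (suc j) e = cong suc (lookup-injective u i j e)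

Monochromatic : ∀ {n} → Digraph n → (Fin n → ℕ) → Set
Monochromatic D c = ∃ λ j → DirectedCycleIn D (λ v → c v ≡ j)

-- A monochromatic cycle uses only arcs with equally coloured ends, so the digraphs are compared on
-- those alone.
monochromatic-map : ∀ {n} {D E : Digraph n} {c c′ : Fin n → ℕ} →
  (∀ {u v} → c u ≡ c v → c′ u ≡ c′ v) → (∀ {u v} → c u ≡ c v → Arc D u v → Arc E u v) →
  Monochromatic D c → Monochromatic E c′
monochromatic-map h k (j , C) = _ ,
  cycle-map C (λ i → h (trans (w-in i) (sym (w-in zero)))) (λ i i′ → k (trans (w-in i) (sym (w-in i′))))
  where open DirectedCycleIn C

module Saturation {n : ℕ} (G : Digraph n) (R : Fin n → Fin n → Set) (G⊆R : ∀ {u v} → Arc G u v → R u v)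
                  (c : Fin n → ℕ) (K : ℕ) (x y : Fin n) (cx : c x ≡ 0)
                  (δ₀ : Bool) (close : Directed R δ₀ x y)
                  (proper : ¬ Monochromatic G c) (bounded : ∀ v → c v ≤ K) where

  open Growth G R G⊆R c K x y cx δ₀ close
  open DecMembership (_≟_ {n}) using (_∈?_)
  private V = Fin n

  Saturated : List V → Set
  Saturated S = ∀ i → i ≤ K → ¬ DirectedCycleIn G (Stage S i)

  -- A cycle missing `S` would be monochromatic under `c`. Hence every cycle that violates
  -- saturation can be appended to the history.
  cycle-has-old : ∀ {S i} (C : DirectedCycleIn G (Stage S i)) → ∃[ t ] DirectedCycleIn.w C t ∈ S
  cycle-has-old {S} {i} C with any? (λ t → DirectedCycleIn.w C t ∈? S)
  ... | yes p = p
  ... | no ¬p = ⊥-elim (proper (next i , cycle-map C col (λ _ _ → id)))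
    where
      col : ∀ t → c (DirectedCycleIn.w C t) ≡ next i
      col t with DirectedCycleIn.w-in C t
      ... | old a _ = ⊥-elim (¬p (t , a))
      ... | new _ e = e

  -- A cycle within `S` would be monochromatic as well, so each appended cycle enlarges the set.
  cycle-has-new : ∀ {S i} (C : DirectedCycleIn G (Stage S i)) → ∃[ t ] DirectedCycleIn.w C t ∉ S
  cycle-has-new {S} {i} C with any? (λ t → ¬? (DirectedCycleIn.w C t ∈? S))
  ... | yes p = p
  ... | no ¬p = ⊥-elim (proper (i , cycle-map C col (λ _ _ → id)))
    where
      col : ∀ t → c (DirectedCycleIn.w C t) ≡ i
      col t with DirectedCycleIn.w-in C t
      ... | old _ e = e
      ... | new a _ = ⊥-elim (¬p (t , a))

  unique-length : ∀ {W : List V} → Unique W → length W ≤ n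
  unique-length u = injective⇒≤ (λ {i} {j} → lookup-injective u i j)

  -- `W` witnesses the size of `S` without repetitions and gains a vertex in each round. At fuel 0
  -- it would have `suc n` members.
  saturate : ∀ fuel {S} → History S → (W : List V) → Unique W → All (_∈ S) W → fuel + length W ≡ suc n →
             ∃[ S′ ] History S′ × Saturated S′
  saturate zero h W uW _ e = ⊥-elim (ℕ.1+n≰n (subst (_≤ n) e (unique-length uW)))
  saturate (suc fuel) {S} h W uW W⊆S e with any? (λ (i : Fin (suc K)) → cycle? G (stage? S (toℕ i)))
  ... | no none = S , h , λ i i≤K C → none (fromℕ< (s≤s i≤K) , subst (DirectedCycleIn G ∘ Stage S) (sym (toℕ-fromℕ< (s≤s i≤K))) C)
  ... | yes (i , C) with cycle-has-old C | cycle-has-new C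
  ...   | t , t∈ | s , s∉ =
    saturate fuel (grow h (toℕ i) (listing-cycle C) (listing-in C) (∈-tabulate⁺ {f = DirectedCycleIn.w C} t) t∈) (DirectedCycleIn.w C s ∷ W)
      (unique-∷ (s∉ ∘ All.lookup W⊆S) uW)
      (∈-++⁺ˡ (∈-tabulate⁺ {f = DirectedCycleIn.w C} s) All.∷ All.map (∈-++⁺ʳ (listing C)) W⊆S)
      (trans (ℕ.+-suc fuel (length W)) e)

  saturated : ∃[ S ] History S × Saturated S
  saturated = saturate n init (x ∷ []) (All.[] AllPairs.∷ AllPairs.[]) (here refl All.∷ All.[]) (ℕ.+-comm n 1)

  history-start : ∀ {S} → History S → x ∈ S
  history-start init = here refl
  history-start (grow h _ {C} _ _ _ _) = ∈-++⁺ʳ C (history-start h)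

  -- Used later to confine the chain: a vertex with an arc in the partial digraph lies in A or is y.
  history-arc : ∀ {S} → History S → ∀ {v} → v ∈ S → v ≡ x ⊎ ∃ (Arc G v)
  history-arc init (here e) = inj₁ e
  history-arc (grow h _ {C} cyc _ _ _) v∈ with ∈-++⁻ C v∈
  ... | inj₂ i = history-arc h i
  ... | inj₁ i with rotate cyc i
  ...   | _ , [ r ] , _   = inj₂ (_ , r)
  ...   | _ , r ∷ _ , _ = inj₂ (_ , r)

  next-injective : ∀ {i j} → next i ≡ next j → i ≡ j
  next-injective {i} {j} e with next j in f
  ... | zero  = trans (next-0 i e) (sym (next-0 j f))
  ... | suc l = trans (next-suc i l e) (sym (next-suc j l f))

  next-surjective : ∀ j → j ≤ K → ∃[ i ] i ≤ K × next i ≡ j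
  next-surjective zero j≤ = K , ℕ.≤-refl , eq
    where
      eq : next K ≡ 0
      eq with K ℕ.≟ K
      ... | yes _ = refl
      ... | no ne = ⊥-elim (ne refl)
  next-surjective (suc j) j< = j , ℕ.<⇒≤ j< , eq
    where
      eq : next j ≡ suc j
      eq with j ℕ.≟ K
      ... | yes refl = ⊥-elim (ℕ.1+n≰n j<)
      ... | no _     = refl

  next-bounded : ∀ i → i ≤ K → next i ≤ K
  next-bounded i i≤ with i ℕ.≟ K
  ... | yes _ = z≤n
  ... | no ne = ℕ.≤∧≢⇒< i≤ ne

  shifted : List V → V → ℕ
  shifted S v with v ∈? S
  ... | yes _ = next (c v)
  ... | no  _ = c v

  shifted-bounded : ∀ S v → shifted S v ≤ K
  shifted-bounded S v with v ∈? S
  ... | yes _ = next-bounded (c v) (bounded v)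
  ... | no  _ = bounded v

  -- After the shift, the class of colour `next i` lies in the set searched for cycles at stage `i`.
  -- Every colour up to `K` is some `next i`, so saturation handles all classes.
  shifted-stage : ∀ S i v → shifted S v ≡ next i → Stage S i v
  shifted-stage S i v e with v ∈? S
  ... | yes p = old p (next-injective e)
  ... | no  p = new p e

  shifted-proper : ∀ S → Saturated S → ¬ Monochromatic G (shifted S)
  shifted-proper S sat (j , C) with next-surjective j (subst (_≤ K) (DirectedCycleIn.w-in C zero) (shifted-bounded S _))
  ... | i , i≤ , refl = sat i i≤ (cycle-map C (λ t → shifted-stage S i _ (DirectedCycleIn.w-in C t)) (λ _ _ → id))

  separate-or-chain : 1 ≤ K → c y ≡ 0 → y ≢ x →
    ∀ pat → Ends (suc K) pat → Sparse pat → ¬ Double (pat 1) →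
    (∃[ c′ ] ¬ Monochromatic G c′ × (∀ v → c′ v ≤ K) × c′ x ≢ c′ y) ⊎
    Chain R y (λ v → v ≡ x ⊎ ∃ (Arc G v)) (suc K) pat y
  separate-or-chain K≥1 cy y≢x pat ends sparse nd with saturated
  ... | S , h , sat with y ∈? S in eq
  ...   | yes y∈S = inj₂ (chain-mono (history-arc h)
                    -- Colour 0 is `next K`, so the first step leads from `y` to colour `K`, and
                    -- `suc K` steps reach colour 0.
                    (chain-from-vertex h K pat ends sparse nd y∈S y≢x (λ i e → next-0 i (trans e cy))))
  ...   | no  y∉S = inj₁ (shifted S , shifted-proper S sat , shifted-bounded S , differ)
    where
      moved : shifted S x ≡ next 0
      moved with x ∈? S
      ... | yes _ = cong next cx
      ... | no ne = ⊥-elim (ne (history-start h))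
      kept : shifted S y ≡ 0
      kept with y ∈? S
      ... | yes p = ⊥-elim (y∉S p)
      ... | no _  = cy
      differ : shifted S x ≢ shifted S y
      -- `x` moves to `next 0`, which is not 0 because there are at least two colours.
      differ e with next-0 0 (trans (sym moved) (trans e kept))
      ... | refl = ℕ.1+n≰n K≥1

-- Exchanging colour 0 with another colour.

swap₀ : ℕ → ℕ → ℕ
swap₀ r i with i ℕ.≟ r | i ℕ.≟ 0
... | yes _ | _     = 0
... | no _  | yes _ = r
... | no _  | no _  = i

swap₀-self : ∀ r → swap₀ r r ≡ 0
swap₀-self r with r ℕ.≟ r
... | yes _ = refl
... | no ne = ⊥-elim (ne refl)

swap₀-injective : ∀ r {i j} → swap₀ r i ≡ swap₀ r j → i ≡ j
swap₀-injective r {i} {j} e with i ℕ.≟ r | i ℕ.≟ 0 | j ℕ.≟ r | j ℕ.≟ 0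
... | yes a | _     | yes b | _     = trans a (sym b)
... | yes a | _     | no _  | yes b = trans a (trans (sym e) (sym b))
... | yes a | _     | no _  | no b  = ⊥-elim (b (sym e))
... | no _  | yes a | yes b | _     = trans a (trans (sym e) (sym b))
... | no _  | yes a | no _  | yes b = trans a (sym b)
... | no _  | yes a | no b  | no _  = ⊥-elim (b (sym e))
... | no _  | no a  | yes _ | _     = ⊥-elim (a e)
... | no a  | no _  | no _  | yes _ = ⊥-elim (a e)
... | no _  | no _  | no _  | no _  = e

swap₀-bounded : ∀ {r i K} → r ≤ K → i ≤ K → swap₀ r i ≤ K
swap₀-bounded {r} {i} r≤ i≤ with i ℕ.≟ r | i ℕ.≟ 0
... | yes _ | _     = z≤n
... | no _  | yes _ = r≤
... | no _  | no _  = i≤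

⌊⌋-sound : ∀ {P : Set} (P? : Dec P) → ⌊ P? ⌋ ≡ true → P
⌊⌋-sound (yes p) _ = p

⌊⌋-complete : ∀ {P : Set} (P? : Dec P) → P → ⌊ P? ⌋ ≡ true
⌊⌋-complete (yes _) _ = refl
⌊⌋-complete (no ¬p) p = ⊥-elim (¬p p)

-- Greedy colouring, inserting the arcs at y one by one.

module Extension {n : ℕ} (D : Digraph n) (K : ℕ) (K≥1 : 1 ≤ K) (δ₀ : Bool) (pat : ℕ → Bool → Bool)
                 (ends : ∀ δ → pat (suc K) δ ≡ true → δ ≡ δ₀)
                 (sparse : ∀ i → Double (pat i) → ¬ Double (pat (suc i)))
                 (nd : ¬ Double (pat 1)) where

  open DecMembership (_≟_ {n}) using (_∈?_)
  private V = Fin n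

  Colours : (V → Bool) → (V → ℕ) → Set
  Colours A c = (∀ j → ¬ DirectedCycleIn D (λ v → A v ≡ true × c v ≡ j)) × (∀ v → c v ≤ K)

  Rooted : (V → Bool) → V → Set
  Rooted A y = Chain (Arc D) y (λ w → w ≡ y ⊎ A w ≡ true) (suc K) pat y

  insert : (V → Bool) → V → V → Bool
  insert A y v = A v ∨ ⌊ v ≟ y ⌋

  module _ (A : V → Bool) (y : V) (Ay : A y ≡ false) where

    Inside : V → Set
    Inside v = insert A y v ≡ true

    inside-cases : ∀ {v} → Inside v → v ≡ y ⊎ A v ≡ true
    inside-cases {v} i with A v
    ... | true  = inj₂ refl
    ... | false = inj₁ (⌊⌋-sound (v ≟ y) i)

    -- Only arcs at `y` in direction `δ₀` are restricted: those into `y` for `true`, those out of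
    -- `y` for `false`. `X` lists the neighbours whose arcs have been inserted.
    Allowed : Bool → List V → V → V → Set
    Allowed true  X u v = v ≡ y → u ∈ X
    Allowed false X u v = u ≡ y → v ∈ X

    allowed? : ∀ δ X u v → Dec (Allowed δ X u v)
    allowed? true  X u v = (v ≟ y) →-dec (u ∈? X)
    allowed? false X u v = (u ≟ y) →-dec (v ∈? X)

    Link : List V → V → V → Set
    Link X u v = Arc D u v × Inside u × Inside v × Allowed δ₀ X u v

    link? : ∀ X u v → Dec (Link X u v)
    link? X u v = (arc D u v Bool.≟ true) ×-dec (insert A y u Bool.≟ true)
                  ×-dec (insert A y v Bool.≟ true) ×-dec allowed? δ₀ X u v

    partial : List V → Digraph n
    partial X = record { arc = λ u v → ⌊ link? X u v ⌋ ; loopless = irreflexive }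
      where
        irreflexive : ∀ v → ⌊ link? X v v ⌋ ≡ false
        irreflexive v with link? X v v
        ... | no _  = refl
        ... | yes l = ⊥-elim (Bool.not-¬ (loopless D v) (proj₁ l))

    partial-link : ∀ X {u v} → Arc (partial X) u v → Link X u v
    partial-link X {u} {v} = ⌊⌋-sound (link? X u v)

    link-partial : ∀ X {u v} → Link X u v → Arc (partial X) u v
    link-partial X {u} {v} = ⌊⌋-complete (link? X u v)

    -- With nothing inserted, `y` has no arc in or no arc out, according to `δ₀`.
    y∉cycle : ∀ {P} (C : DirectedCycleIn (partial []) P) i → DirectedCycleIn.w C i ≢ y
    y∉cycle C i e = refute δ₀ (λ r → proj₂ (proj₂ (proj₂ (partial-link [] r))))
      where
        refute : ∀ δ → (∀ {u v} → Arc (partial []) u v → Allowed δ [] u v) → ⊥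
        refute true al with predecessor C i
        ... | _ , r with al r e
        ...   | ()
        refute false al with successor C i
        ... | _ , r with al r e
        ...   | ()

    proper-[] : ∀ {c} → Colours A c → ¬ Monochromatic (partial []) c
    proper-[] (ok , _) (j , C) = ok j (cycle-map C (λ i → inA i , DirectedCycleIn.w-in C i) (λ _ _ → proj₁ ∘ partial-link []))
      where
        inA : ∀ i → A (DirectedCycleIn.w C i) ≡ true
        inA i with inside-cases (proj₁ (proj₂ (partial-link [] (proj₂ (successor C i)))))
        ... | inj₁ e = ⊥-elim (y∉cycle C i e)
        ... | inj₂ a = a

    Critical : V → (V → ℕ) → Set
    Critical x c = Directed (Arc D) δ₀ x y × A x ≡ true × c x ≡ c y

    inside-neighbour : ∀ {x} → Arc D x y ⊎ Arc D y x → Inside x → A x ≡ true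
    inside-neighbour r i with inside-cases i
    ... | inj₂ a = a
    inside-neighbour (inj₁ r) i | inj₁ refl = ⊥-elim (Bool.not-¬ (loopless D y) r)
    inside-neighbour (inj₂ r) i | inj₁ refl = ⊥-elim (Bool.not-¬ (loopless D y) r)

    -- The only arc gained joins `x` and `y` in direction `δ₀`; on a monochromatic cycle its ends
    -- would make `x` critical.
    proper-∷ : ∀ {x X c} → ¬ Monochromatic (partial X) c → ¬ Critical x c → ¬ Monochromatic (partial (x ∷ X)) c
    proper-∷ {x} {X} {c} ok nc M = ok (monochromatic-map id (λ e r → link-partial X (restrict e (partial-link (x ∷ X) r))) M)
      where
        shrink : ∀ δ {u v} → δ₀ ≡ δ → c u ≡ c v → Arc D u v → Inside u → Inside v → Allowed δ (x ∷ X) u v → Allowed δ X u v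
        shrink true refl e r a b al refl with al refl
        ... | here refl = ⊥-elim (nc (r , inside-neighbour (inj₁ r) a , e))
        ... | there i   = i
        shrink false refl e r a b al refl with al refl
        ... | here refl = ⊥-elim (nc (r , inside-neighbour (inj₂ r) b , sym e))
        ... | there i   = i
        restrict : ∀ {u v} → c u ≡ c v → Link (x ∷ X) u v → Link X u v
        restrict e (r , a , b , al) = r , a , b , shrink δ₀ refl e r a b al

    critical? : ∀ x c → Dec (Critical x c)
    critical? x c = directed? δ₀ ×-dec (A x Bool.≟ true) ×-dec (c x ℕ.≟ c y)
      where
        directed? : ∀ δ → Dec (Directed (Arc D) δ x y)
        directed? true  = arc D x y Bool.≟ true
        directed? false = arc D y x Bool.≟ true

    -- If `x` is critical, a separating colouring that is proper for `X` replaces the current one.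
    -- It gives `x` and `y` different colours, so it survives the insertion.
    colour-or-root : ∀ {c} → Colours A c → ∀ X →
      (∃[ c′ ] ¬ Monochromatic (partial X) c′ × (∀ v → c′ v ≤ K)) ⊎ Rooted A y
    colour-or-root {c} ok []      = inj₁ (c , proper-[] ok , proj₂ ok)
    colour-or-root     ok (x ∷ X) with colour-or-root ok X
    ... | inj₂ r = inj₂ r
    ... | inj₁ (c , p , b) with critical? x c
    ...   | no nc = inj₁ (c , proper-∷ p nc , b)
    ...   | yes (close , Ax , e) = step (separate-or-chain K≥1 (trans (cong (swap₀ (c x)) (sym e)) (swap₀-self (c x)))
                                          (λ { refl → Bool.not-¬ Ay Ax }) pat ends sparse nd)
      where
        -- The exchange of colours gives `x`, and with it `y`, colour 0.
        open Saturation (partial X) (Arc D) (proj₁ ∘ partial-link X) (swap₀ (c x) ∘ c) K x y (swap₀-self (c x)) δ₀ close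
               (p ∘ monochromatic-map (swap₀-injective (c x)) (λ _ → id)) (λ v → swap₀-bounded (b x) (b v))
        inA : ∀ {v} → v ≡ x ⊎ ∃ (Arc (partial X) v) → v ≡ y ⊎ A v ≡ true
        inA (inj₁ refl)    = inj₂ Ax
        inA (inj₂ (_ , r)) = inside-cases (proj₁ (proj₂ (partial-link X r)))
        step : _ → _
        step (inj₁ (c′ , p′ , b′ , d)) = inj₁ (c′ , proper-∷ p′ (λ (_ , _ , e′) → d e′) , b′)
        step (inj₂ ch)                 = inj₂ (chain-mono inA ch)

    extend : ∀ {c} → Colours A c → (∃[ c′ ] Colours (insert A y) c′) ⊎ Rooted A y
    extend ok with colour-or-root ok (allFin n)
    ... | inj₂ r           = inj₂ r
    ... | inj₁ (c , p , b) = inj₁ (c ,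
            (λ j C → p (j , cycle-map C (proj₂ ∘ DirectedCycleIn.w-in C)
                       (λ i i′ r → link-partial (allFin n) (r , proj₁ (DirectedCycleIn.w-in C i) , proj₁ (DirectedCycleIn.w-in C i′) , everything δ₀)))) ,
            b)
      where
        everything : ∀ δ {u v} → Allowed δ (allFin n) u v
        everything true  {u}     _ = ∈-allFin u
        everything false {v = v} _ = ∈-allFin v

  _⊑_ : (V → Bool) → (V → Bool) → Set
  A ⊑ A′ = ∀ {v} → A v ≡ true → A′ v ≡ true

  rooted-mono : ∀ {A A′ y} → A ⊑ A′ → Rooted A y → Rooted A′ y
  rooted-mono h = chain-mono [ inj₁ , inj₂ ∘ h ]′

  -- One pass suffices: a rejected vertex stays rooted because the coloured set only grows.
  greedy : ∀ (L : List V) {A c} → Colours A c →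
           ∃[ A′ ] ∃[ c′ ] A ⊑ A′ × Colours A′ c′ × (∀ {v} → v ∈ L → A′ v ≡ true ⊎ Rooted A′ v)
  greedy [] {A} {c} ok = A , c , id , ok , λ ()
  greedy (y ∷ L) {A} ok with A y in Ay
  greedy (y ∷ L) {A} ok | true with greedy L ok
  ... | A′ , c′ , h , ok′ , all = A′ , c′ , h , ok′ , λ { (here refl) → inj₁ (h Ay) ; (there i) → all i }
  greedy (y ∷ L) {A} ok | false with extend A y Ay ok
  ... | inj₂ r with greedy L ok
  ...   | A′ , c′ , h , ok′ , all = A′ , c′ , h , ok′ , λ { (here refl) → inj₂ (rooted-mono h r) ; (there i) → all i }
  greedy (y ∷ L) {A} ok | false | inj₁ (c₁ , ok₁) with greedy L ok₁
  ...   | A′ , c′ , h , ok′ , all = A′ , c′ , (λ {v} e → h (cong (_∨ ⌊ v ≟ y ⌋) e)) , ok′ ,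
          λ { (here refl) → inj₁ (h (trans (cong (A y ∨_) (⌊⌋-complete (y ≟ y) refl)) (Bool.∨-zeroʳ (A y)))) ; (there i) → all i }

  partition : ∃[ A ] ∃[ c ] Colours A c × (∀ v → A v ≡ false → Rooted A v)
  partition with greedy (allFin n) {λ _ → false} {λ _ → 0} ((λ j C → Bool.not-¬ refl (proj₁ (DirectedCycleIn.w-in C zero))) , λ _ → z≤n)
  ... | A , c , _ , ok , all = A , c , ok , rooted
    where
      rooted : ∀ v → A v ≡ false → Rooted A v
      rooted v e with all (∈-allFin v)
      ... | inj₁ t = ⊥-elim (Bool.not-¬ e t)
      ... | inj₂ r = r

-- The subdigraph outside A and its colourings.

module InducedComplement {d : ℕ} (D : Digraph d) (A : Fin d → Bool) where

  private V = Fin d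

  vertices : List V
  vertices = filter (λ v → A v Bool.≟ false) (allFin d)

  size : ℕ
  size = length vertices

  embed : Fin size → V
  embed = lookup vertices

  embed-injective : ∀ {i j} → embed i ≡ embed j → i ≡ j
  embed-injective {i} {j} = lookup-injective (Unique.filter⁺ _ (Unique.allFin⁺ d)) i j

  embed-outside : ∀ i → A (embed i) ≡ false
  embed-outside i = proj₂ (∈-filter⁻ (λ v → A v Bool.≟ false) {xs = allFin d} (∈-lookup i))

  index : ∀ {v} → A v ≡ false → ∃[ i ] embed i ≡ v
  index {v} e = Any.index m , sym (lookup-index m)
    where
      m : v ∈ vertices
      m = ∈-filter⁺ (λ v → A v Bool.≟ false) (∈-allFin v) e

  induced : Digraph size
  induced = record { arc = λ i j → arc D (embed i) (embed j) ; loopless = loopless D ∘ embed }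

  module _ {k : ℕ} {c : V → ℕ} (proper : ∀ j → ¬ DirectedCycleIn D (λ v → A v ≡ true × c v ≡ j))
           (bounded : ∀ v → c v < k) {j : ℕ} {c′ : Fin size → Fin j} (proper′ : AcyclicColouring induced j c′) where

    -- The boolean comes with its equation, so that proofs can split on it while keeping the
    -- membership fact.
    palette : ∀ v b → A v ≡ b → Fin k ⊎ Fin j
    palette v true  _ = inj₁ (fromℕ< (bounded v))
    palette v false e = inj₂ (c′ (proj₁ (index e)))

    combined : V → Fin k ⊎ Fin j
    combined v = palette v (A v) refl

    combined-left : ∀ v {i} → combined v ≡ inj₁ i → A v ≡ true × c v ≡ toℕ i
    combined-left v = go (A v) refl
      where
        go : ∀ b (e : A v ≡ b) {i} → palette v b e ≡ inj₁ i → A v ≡ true × c v ≡ toℕ i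
        go true e refl = e , sym (toℕ-fromℕ< (bounded v))
        go false e ()

    combined-right : ∀ v {i} → combined v ≡ inj₂ i → ∃[ u ] embed u ≡ v × c′ u ≡ i
    combined-right v = go (A v) refl
      where
        go : ∀ b (e : A v ≡ b) {i} → palette v b e ≡ inj₂ i → ∃[ u ] embed u ≡ v × c′ u ≡ i
        go true e ()
        go false e eq = proj₁ (index e) , proj₂ (index e) , Sum.inj₂-injective eq

    -- The palettes are disjoint, so a monochromatic cycle stays in `A` or outside it.
    combined-proper : ∀ z → ¬ DirectedCycleIn D (λ v → combined v ≡ z)
    combined-proper (inj₁ i) C = proper (toℕ i) (cycle-map C (λ t → combined-left _ (DirectedCycleIn.w-in C t)) (λ _ _ → id))
    combined-proper (inj₂ i) C = proper′ i record
      { m = m ; w = proj₁ ∘ pre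
      ; w-inj = λ {a} {b} e → w-inj (trans (sym (at a)) (trans (cong embed e) (at b)))
      ; w-step = λ t → trans (cong₂ (arc D) (at _) (at _)) (w-step t)
      ; w-back = trans (cong₂ (arc D) (at _) (at _)) w-back
      ; w-in = proj₂ ∘ proj₂ ∘ pre }
      where
        open DirectedCycleIn C
        pre : ∀ t → ∃[ u ] embed u ≡ w t × c′ u ≡ i
        pre t = combined-right (w t) (w-in t)
        at : ∀ t → embed (proj₁ (pre t)) ≡ w t
        at = proj₁ ∘ proj₂ ∘ pre

    combined-colourable : Colourable D (k + j)
    combined-colourable = join k j ∘ combined , λ i C → combined-proper (splitAt k i)
        (cycle-map C (λ t → trans (sym (splitAt-join k j (combined _))) (cong (splitAt k) (DirectedCycleIn.w-in C t))) (λ _ _ → id))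

-- The added part of F* as a pattern of steps.

module Attached {h : ℕ} (F : Digraph h) (v₀ : Fin h) (K : ℕ) (Q : Digraph (suc K)) (good : Good (suc K) (s≤s z≤n) Q) (out : Bool) where

  N : ℕ
  N = suc K

  F* : Digraph (h + N)
  F* = Fstar F v₀ N (s≤s z≤n) Q out

  -- The last step is read from v_k to v₀, so the arc (v₀, v_k) has direction `false`.
  δ₀ : Bool
  δ₀ = not out

  -- Step 0 is the digon between v₀ and v₁, step `suc i` with `i < K` joins the vertices of `Q` with
  -- indices `i` and `suc i`, and step `N` closes the cycle.
  pat : ℕ → Bool → Bool
  pat zero    _ = true
  pat (suc i) δ with i ℕ.<? K
  pat (suc i) true  | yes p = arc Q (inject₁ (fromℕ< p)) (suc (fromℕ< p))
  pat (suc i) false | yes p = arc Q (suc (fromℕ< p)) (inject₁ (fromℕ< p))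
  pat (suc i) δ     | no _  = ⌊ δ Bool.≟ δ₀ ⌋

  pat-ends : ∀ δ → pat N δ ≡ true → δ ≡ δ₀
  pat-ends δ e with K ℕ.<? K
  ... | yes p = ⊥-elim (ℕ.<-irrefl refl p)
  ... | no _  = ⌊⌋-sound (δ Bool.≟ δ₀) e

  pat-end : pat N δ₀ ≡ true
  pat-end with K ℕ.<? K
  ... | yes p = ⊥-elim (ℕ.<-irrefl refl p)
  ... | no _  = ⌊⌋-complete (δ₀ Bool.≟ δ₀) refl

  closing-single : ¬ (⌊ true Bool.≟ δ₀ ⌋ ≡ true × ⌊ false Bool.≟ δ₀ ⌋ ≡ true)
  closing-single (a , b) with trans (⌊⌋-sound (true Bool.≟ δ₀) a) (sym (⌊⌋-sound (false Bool.≟ δ₀) b))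
  ... | ()

  ≤-sum : ∀ {x xs} → x ∈ xs → x ≤ sum xs
  ≤-sum {xs = x ∷ xs} (here refl) = ℕ.m≤m+n x (sum xs)
  ≤-sum {xs = y ∷ xs} (there i)   = ℕ.≤-trans (≤-sum i) (ℕ.m≤n+m (sum xs) y)

  -- A digon between v₁ and v₂ would give v₁ total degree at least 2; if `K` is 0, step 1 is already
  -- the closing one.
  first-single : ¬ Double (pat 1)
  first-single with 0 ℕ.<? K
  ... | no _  = closing-single
  ... | yes p = λ (a , b) → ℕ.1+n≰n (subst (2 ≤_) (Good.deg-v₁ good)
      (ℕ.+-mono-≤ (counted (λ w → arc Q zero w) (subst (λ v → arc Q v (suc (fromℕ< p)) ≡ true) start a))
                  (counted (λ w → arc Q w zero) (subst (λ v → arc Q (suc (fromℕ< p)) v ≡ true) start b))))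
    where
      start : inject₁ (fromℕ< p) ≡ zero
      start = toℕ-injective (trans (toℕ-inject₁ _) (toℕ-fromℕ< p))
      counted : ∀ (f : Fin N → Bool) {w} → f w ≡ true → 1 ≤ sum (map (bit ∘ f) (allFin N))
      counted f {w} e = subst (_≤ sum (map (bit ∘ f) (allFin N))) (cong bit e) (≤-sum (∈-map⁺ (bit ∘ f) (∈-allFin w)))

  -- Consecutive digons within `Q` would share a vertex and hence coincide, which their indices
  -- forbid. The first step of `Q` and the closing step are never digons.
  pat-sparse : ∀ i → Double (pat i) → ¬ Double (pat (suc i))
  pat-sparse zero _ = first-single
  pat-sparse (suc i) with i ℕ.<? K | suc i ℕ.<? K
  ... | no _  | _     = λ d _ → closing-single d
  ... | yes _ | no _  = λ _ → closing-single
  ... | yes p | yes q = λ (a , a′) (b , b′) →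
    absurd (Good.digons good (inject₁ (fromℕ< p)) (suc (fromℕ< p)) (inject₁ (fromℕ< q)) (suc (fromℕ< q)) (a , a′) (b , b′) (inj₂ (inj₂ (inj₁ middle))))
    where
      i₀ : toℕ (inject₁ (fromℕ< p)) ≡ i
      i₀ = trans (toℕ-inject₁ _) (toℕ-fromℕ< p)
      i₁ : toℕ (inject₁ (fromℕ< q)) ≡ suc i
      i₁ = trans (toℕ-inject₁ _) (toℕ-fromℕ< q)
      i₂ : toℕ (suc (fromℕ< q)) ≡ suc (suc i)
      i₂ = cong suc (toℕ-fromℕ< q)
      middle : suc (fromℕ< p) ≡ inject₁ (fromℕ< q)
      middle = toℕ-injective (trans (cong suc (toℕ-fromℕ< p)) (sym i₁))
      absurd : ∀ {X Y : Set} → (inject₁ (fromℕ< p) ≡ inject₁ (fromℕ< q) × X) ⊎ (inject₁ (fromℕ< p) ≡ suc (fromℕ< q) × Y) → ⊥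
      absurd (inj₁ (e , _)) = ℕ.1+n≢n (sym (trans (sym i₀) (trans (cong toℕ e) i₁)))
      absurd (inj₂ (e , _)) = ℕ.<⇒≢ (ℕ.m<n+m i (s≤s z≤n)) (trans (sym i₀) (trans (cong toℕ e) i₂))

  pat-forward : ∀ {i j} → toℕ j ≡ suc (toℕ i) → Arc Q i j → pat (suc (toℕ i)) true ≡ true
  pat-forward {i} {j} e r with toℕ i ℕ.<? K
  ... | no ¬p = ⊥-elim (¬p (subst (_≤ K) e (toℕ≤pred[n] j)))
  ... | yes p = trans (cong₂ (arc Q) (toℕ-injective (trans (toℕ-inject₁ _) (toℕ-fromℕ< p)))
                                     (toℕ-injective (trans (cong suc (toℕ-fromℕ< p)) (sym e)))) r

  pat-backward : ∀ {i j} → toℕ i ≡ suc (toℕ j) → Arc Q i j → pat (suc (toℕ j)) false ≡ true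
  pat-backward {i} {j} e r with toℕ j ℕ.<? K
  ... | no ¬p = ⊥-elim (¬p (subst (_≤ K) e (toℕ≤pred[n] i)))
  ... | yes p = trans (cong₂ (arc Q) (toℕ-injective (trans (cong suc (toℕ-fromℕ< p)) (sym e)))
                                     (toℕ-injective (trans (toℕ-inject₁ _) (toℕ-fromℕ< p)))) r

  -- The cycle v₀ v₁ … v_k v₀ is read off positions 0, …, N + 1, so v₀ occurs twice.
  data Position : ℕ → Fin (h + N) → Set where
    root  : Position 0 (v₀ ↑ˡ N)
    spoke : ∀ i → Position (suc (toℕ i)) (h ↑ʳ i)
    wrap  : Position (suc N) (v₀ ↑ˡ N)

  spoke-at : ∀ i {l} → toℕ i ≡ l → Position (suc l) (h ↑ʳ i)
  spoke-at i refl = spoke i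

  position-unique : ∀ {i j s t} → i ≡ j → Position i s → Position j t → s ≡ t
  position-unique _ root root = refl
  position-unique e (spoke i) (spoke j) = cong (h ↑ʳ_) (toℕ-injective (ℕ.suc-injective e))
  position-unique e (spoke i) wrap = ⊥-elim (ℕ.<-irrefl (ℕ.suc-injective e) (toℕ<n i))
  position-unique e wrap (spoke i) = ⊥-elim (ℕ.<-irrefl (ℕ.suc-injective (sym e)) (toℕ<n i))
  position-unique _ wrap wrap = refl

  Between : Bool → ℕ → Fin (h + N) → Fin (h + N) → Set
  Between true  i s t = Position i s × Position (suc i) t
  Between false i s t = Position i t × Position (suc i) s

  between-unique : ∀ δ {i s t s′ t′} → Between δ i s t → Between δ i s′ t′ → (s ≡ s′) × (t ≡ t′)
  between-unique true  (a , b) (a′ , b′) = position-unique refl a a′ , position-unique refl b b′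
  between-unique false (a , b) (a′ , b′) = position-unique refl b b′ , position-unique refl a a′

  data View (s t : Fin (h + N)) : Set where
    in-F : ∀ a b → Arc F a b → s ≡ a ↑ˡ N → t ≡ b ↑ˡ N → View s t
    step : ∀ i δ → i ≤ N → pat i δ ≡ true → Between δ i s t → View s t

  ∧-true : ∀ {a b} → (a ∧ b) ≡ true → a ≡ true × b ≡ true
  ∧-true {true} e = refl , e

  ∨-true : ∀ {a b} → (a ∨ b) ≡ true → a ≡ true ⊎ b ≡ true
  ∨-true {true}  e = inj₁ refl
  ∨-true {false} e = inj₂ e

  view-arc : ∀ s t → Arc F* s t → View s t
  view-arc s t r with splitAt h s in es | splitAt h t in et
  ... | inj₁ a | inj₁ b = in-F a b r (sym (splitAt⁻¹-↑ˡ es)) (sym (splitAt⁻¹-↑ˡ et))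
  ... | inj₂ i | inj₂ j = go (splitAt⁻¹-↑ʳ es) (splitAt⁻¹-↑ʳ et) (Good.sub good i j r)
    where
      go : h ↑ʳ i ≡ s → h ↑ʳ j ≡ t → PathEdge i j → View s t
      go refl refl (inj₁ e) = step (suc (toℕ i)) true (toℕ<n i) (pat-forward e r)
                                (spoke i , spoke-at j e)
      go refl refl (inj₂ e) = step (suc (toℕ j)) false (toℕ<n j) (pat-backward e r)
                                (spoke j , spoke-at i e)
  ... | inj₁ a | inj₂ j = go (splitAt⁻¹-↑ˡ es) (splitAt⁻¹-↑ʳ et) (⌊⌋-sound (a ≟ v₀) (proj₁ (∧-true r))) (∨-true (proj₂ (∧-true r)))
    where
      go : a ↑ˡ N ≡ s → h ↑ʳ j ≡ t → a ≡ v₀ → is j zero ≡ true ⊎ (out ∧ is j (fromℕ K)) ≡ true → View s t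
      go refl refl refl (inj₁ e) with ⌊⌋-sound (j ≟ zero) e
      ... | refl = step 0 true z≤n refl (root , spoke zero)
      go refl refl refl (inj₂ e) with ∧-true e
      ... | o , l with ⌊⌋-sound (j ≟ fromℕ K) l
      -- This arc leaves v₀ at position `suc N` and enters v_k at position `N`, hence direction
      -- `false`.
      ...   | refl = step N false ℕ.≤-refl (subst (λ δ → pat N δ ≡ true) (cong not o) pat-end)
                       (spoke-at j (toℕ-fromℕ K) , wrap)
  ... | inj₂ i | inj₁ b = go (splitAt⁻¹-↑ʳ es) (splitAt⁻¹-↑ˡ et) (⌊⌋-sound (b ≟ v₀) (proj₁ (∧-true r))) (∨-true (proj₂ (∧-true r)))
    where
      outwards : ∀ o {b} → (if o then false else b) ≡ true → o ≡ false × b ≡ true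
      outwards false e = refl , e
      go : h ↑ʳ i ≡ s → b ↑ˡ N ≡ t → b ≡ v₀ → is i zero ≡ true ⊎ (if out then false else is i (fromℕ K)) ≡ true → View s t
      go refl refl refl (inj₁ e) with ⌊⌋-sound (i ≟ zero) e
      ... | refl = step 0 false z≤n refl (root , spoke zero)
      go refl refl refl (inj₂ e) with outwards out e
      ... | o , l with ⌊⌋-sound (i ≟ fromℕ K) l
      ...   | refl = step N true ℕ.≤-refl (subst (λ δ → pat N δ ≡ true) (cong not o) pat-end)
                       (spoke-at i (toℕ-fromℕ K) , wrap)

-- Assembling the subdivision of F*.

module Attaching {h : ℕ} (F : Digraph h) (v₀ : Fin h) (K : ℕ) (Q : Digraph (suc K)) (good : Good (suc K) (s≤s z≤n) Q) (out : Bool)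
                 {d : ℕ} (D : Digraph d) (A : Fin d → Bool) {b : ℕ} (B : Digraph b) (e : Fin b → Fin d)
                 (e-injective : ∀ {i j} → e i ≡ e j → i ≡ j) (e-outside : ∀ i → A (e i) ≡ false)
                 (e-arc : ∀ {i j} → Arc B i j → Arc D (e i) (e j)) (sub : Subdivision F B) where

  open Attached F v₀ K Q good out
  open Subdivision sub

  y : Fin d
  y = e (φ v₀)

  module _ (chain : Chain (Arc D) y (λ w → w ≡ y ⊎ A w ≡ true) N pat y) where
    open Chain chain

    link-in-block : ∀ i δ {w} → w ∈ link i δ → w ∈ link i true ++ link i false
    link-in-block i true  = ∈-++⁺ˡ
    link-in-block i false = ∈-++⁺ʳ (link i true)

    node∉link : ∀ i j δ → i ≤ N → j ≤ N → node i ∉ link j δ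
    node∉link i j δ i≤ j≤ m with block-disjoint i j i≤ j≤ (here refl) (there (link-in-block j δ m))
    ... | refl = unique-head (block-unique i i≤) (link-in-block i δ m)

    -- Since `y` is node 0 and no node lies on a link, the case `w ≡ y` is impossible. Membership in
    -- `A` then separates the links from the subdivision of `F`.
    link-inside : ∀ i δ → i ≤ N → ∀ {w} → w ∈ link i δ → A w ≡ true
    link-inside i δ i≤ m with block-in i i≤ (there (link-in-block i δ m))
    ... | inj₁ w≡y = ⊥-elim (node∉link 0 i δ z≤n i≤ (subst (_∈ link i δ) (trans w≡y (sym start)) m))
    ... | inj₂ a   = a

    node-inside : ∀ i → suc i ≤ N → A (node (suc i)) ≡ true
    node-inside i i< with block-in (suc i) i< (here refl)
    ... | inj₂ a = a
    ... | inj₁ n≡y with block-disjoint (suc i) 0 i< z≤n (here refl) (here (trans n≡y (sym start)))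
    ...   | ()

    link-unique : ∀ i δ → i ≤ N → Unique (link i δ)
    link-unique i true  i≤ = unique-++ˡ (link i true) (unique-++ʳ (node i ∷ []) (block-unique i i≤))
    link-unique i false i≤ = unique-++ʳ (link i true) (unique-++ʳ (node i ∷ []) (block-unique i i≤))

    link-disjoint : ∀ i δ δ′ → i ≤ N → ∀ {w} → w ∈ link i δ → w ∈ link i δ′ → δ ≡ δ′
    link-disjoint i true  true  _  _ _ = refl
    link-disjoint i false false _  _ _ = refl
    link-disjoint i true  false i≤ a a′ = ⊥-elim (unique-disjoint (link i true) (unique-++ʳ (node i ∷ []) (block-unique i i≤)) a a′)
    link-disjoint i false true  i≤ a a′ = ⊥-elim (unique-disjoint (link i true) (unique-++ʳ (node i ∷ []) (block-unique i i≤)) a′ a)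

    branch′ : Fin h ⊎ Fin N → Fin d
    branch′ (inj₁ a) = e (φ a)
    branch′ (inj₂ i) = node (suc (toℕ i))

    branch : Fin (h + N) → Fin d
    branch = branch′ ∘ splitAt h

    branch-old : ∀ a → branch (a ↑ˡ N) ≡ e (φ a)
    branch-old a = cong branch′ (splitAt-↑ˡ h a N)

    outside≢inside : ∀ {i w} → A w ≡ true → e i ≢ w
    outside≢inside {i} a refl = Bool.not-¬ (e-outside i) a

    branch′-injective : ∀ z z′ → branch′ z ≡ branch′ z′ → z ≡ z′
    branch′-injective (inj₁ a) (inj₁ a′) q = cong inj₁ (φ-inj (e-injective q))
    branch′-injective (inj₁ a) (inj₂ i)  q = ⊥-elim (outside≢inside (node-inside _ (toℕ<n i)) q)
    branch′-injective (inj₂ i) (inj₁ a)  q = ⊥-elim (outside≢inside (node-inside _ (toℕ<n i)) (sym q))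
    branch′-injective (inj₂ i) (inj₂ j)  q =
      cong inj₂ (toℕ-injective (ℕ.suc-injective (block-disjoint _ _ (toℕ<n i) (toℕ<n j) (here refl) (here q))))

    branch-injective : ∀ {s t} → branch s ≡ branch t → s ≡ t
    branch-injective {s} {t} q = trans (sym (join-splitAt h N s))
      (trans (cong (join h N) (branch′-injective (splitAt h s) (splitAt h t) q)) (join-splitAt h N t))

    position-node : ∀ {i s} → i ≤ N → Position i s → branch s ≡ node i
    position-node _ root      = trans (branch-old v₀) (sym start)
    position-node _ (spoke i) = cong branch′ (splitAt-↑ʳ h N i)
    position-node N<N wrap    = ⊥-elim (ℕ.1+n≰n N<N)

    position-last : ∀ {s} → Position (suc N) s → branch s ≡ y
    position-last p = trans (cong branch (position-unique refl p wrap)) (branch-old v₀)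

    link-path : ∀ i δ → i ≤ N → pat i δ ≡ true → ∀ {s t} → Position i s → Position (suc i) t →
                Path (Directed (Arc D) δ) (branch s) (link i δ) (branch t)
    link-path i δ i≤ r p q rewrite position-node i≤ p with ℕ.m≤n⇒m<n∨m≡n i≤
    ... | inj₁ i<   rewrite position-node i< q = joined i i< δ r
    ... | inj₂ refl rewrite position-last q    = closing δ r

    -- Links are listed by increasing position, so an arc of direction `false` takes its link
    -- reversed.
    stem : ∀ {s t} → View s t → List (Fin d)
    stem (in-F a a′ r _ _)      = map e (inner (path a a′ r))
    stem (step i true  _ _ _) = link i true
    stem (step i false _ _ _) = reverse (link i false)

    -- Both disjointness conditions of a subdivision are decided by where an inner vertex comes
    -- from; this also forgets the reversal.
    data Origin {s t} (w : Fin d) : View s t → Set where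
      from-F    : ∀ {a a′ r p q u} → u ∈ inner (path a a′ r) → w ≡ e u → Origin w (in-F a a′ r p q)
      from-link : ∀ {i δ i≤ r p} → w ∈ link i δ → Origin w (step i δ i≤ r p)

    origin : ∀ {s t} (v : View s t) {w} → w ∈ stem v → Origin w v
    origin (in-F a a′ r _ _) m with ∈-map⁻ e m
    ... | u , i , q = from-F i q
    origin (step i true  _ _ _) m = from-link m
    origin (step i false _ _ _) m = from-link (∈-resp-↭ (↭-reverse (link i false)) m)

    stem-path : ∀ {s t} (v : View s t) → Path (Arc D) (branch s) (stem v) (branch t)
    stem-path (in-F a a′ r refl refl) rewrite branch-old a | branch-old a′ =
      path-map e-arc (linked-path (inner π) (linked π))
      where π = path a a′ r
    stem-path (step i true  i≤ r (p , q)) = link-path i true i≤ r p q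
    stem-path (step i false i≤ r (p , q)) = path-reverse (link-path i false i≤ r p q)

    stem-unique : ∀ {s t} (v : View s t) → Unique (stem v)
    stem-unique (in-F a a′ r _ _) = Unique.map⁺ e-injective
      (unique-++ˡ (inner π) (unique-++ʳ (φ a ∷ []) (unique π)))
      where π = path a a′ r
    stem-unique (step i true  i≤ _ _) = link-unique i true i≤
    stem-unique (step i false i≤ _ _) = unique-resp-↭ (↭-sym (↭-reverse (link i false))) (link-unique i false i≤)

    branch′-avoids : ∀ {s t} {v : View s t} z → ¬ Origin (branch′ z) v
    branch′-avoids (inj₁ c) (from-F {a} {a′} {r} i q) = avoid a a′ r c (subst (_∈ inner (path a a′ r)) (sym (e-injective q)) i)
    branch′-avoids (inj₂ i) (from-F _ q)  = outside≢inside (node-inside _ (toℕ<n i)) (sym q)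
    branch′-avoids (inj₁ c) (from-link {i} {δ} {i≤} m) = outside≢inside (link-inside i δ i≤ m) refl
    branch′-avoids (inj₂ j) (from-link {i} {δ} {i≤} m) = node∉link _ i δ (toℕ<n j) i≤ m

    -- Two origins in `F` are settled by the given subdivision, mixed ones by membership in `A`. For
    -- two links, the blocks fix the step and the two halves of a block fix the direction.
    origin-unique : ∀ {s t s′ t′ w} {v : View s t} {v′ : View s′ t′} → Origin w v → Origin w v′ → (s ≡ s′) × (t ≡ t′)
    origin-unique {v = in-F a a′ r refl refl} {in-F b b′ r′ refl refl} (from-F i refl) (from-F i′ q)
      with disjoint a a′ r b b′ r′ _ i (subst (_∈ inner (path b b′ r′)) (sym (e-injective q)) i′)
    ... | refl , refl = refl , refl
    origin-unique (from-F _ q) (from-link {i} {δ} {i≤} m) = ⊥-elim (outside≢inside (link-inside i δ i≤ m) (sym q))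
    origin-unique (from-link {i} {δ} {i≤} m) (from-F _ q) = ⊥-elim (outside≢inside (link-inside i δ i≤ m) (sym q))
    origin-unique (from-link {i} {δ} {i≤} {_} {p} m) (from-link {i′} {δ′} {i≤′} {_} {p′} m′)
      with block-disjoint i i′ i≤ i≤′ (there (link-in-block i δ m)) (there (link-in-block i′ δ′ m′))
    ... | refl with link-disjoint i δ δ′ i≤ m m′
    ...   | refl = between-unique δ p p′

    directed : ∀ s t → Arc F* s t → DirPath D (branch s) (branch t)
    directed s t r = record
      { inner  = stem v
      ; linked = path-linked (stem-path v)
      ; unique = unique-∷ head∉ (Unique.++⁺ (stem-unique v) (All.[] AllPairs.∷ AllPairs.[])
                   (λ { (i , here refl) → branch∉ t i })) }
      where
        v = view-arc s t r
        branch∉ : ∀ z → branch z ∉ stem v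
        branch∉ z i = branch′-avoids (splitAt h z) (origin v i)
        head∉ : branch s ∉ stem v ++ branch t ∷ []
        head∉ i with ∈-++⁻ (stem v) i
        ... | inj₁ j        = branch∉ s j
        ... | inj₂ (here q) with branch-injective {s} {t} q
        -- Equal ends would make the arc a loop of `F*`.
        ...   | refl = Bool.not-¬ (loopless F* s) r

    subdivision : Subdivision F* D
    subdivision = record
      { φ        = branch
      ; φ-inj    = branch-injective
      ; path     = directed
      ; avoid    = λ s t r c i → branch′-avoids (splitAt h c) (origin (view-arc s t r) i)
      ; disjoint = λ s t r s′ t′ r′ w i i′ → origin-unique (origin (view-arc s t r) i) (origin (view-arc s′ t′ r′) i′) }

-- The bound for F*.

good⇒second-vertex : ∀ {K} {Q : Digraph (suc K)} → Good (suc K) (s≤s z≤n) Q → 1 ≤ K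
good⇒second-vertex {suc K} _ = s≤s z≤n
-- A single vertex without a loop has degree 0, not 1.
good⇒second-vertex {zero} {Q} good with Good.deg-v₁ good
... | q rewrite loopless Q zero with q
...   | ()

-- Fewer than `m` colours outside `A` and `suc K` inside would colour `D` too cheaply, so the
-- complement contains a subdivision of `F`. The image of `v₀` lies outside `A`, hence is rooted.
maderBound-Fstar : ∀ {h} (F : Digraph h) v₀ K Q (good : Good (suc K) (s≤s z≤n) Q) out {m} →
                   MaderBound F m → MaderBound (Fstar F v₀ (suc K) (s≤s z≤n) Q out) (m + suc K)
maderBound-Fstar F v₀ K Q good out {m} F≤m d D dich with partition
  where
    open Attached F v₀ K Q good out
    open Extension D K (good⇒second-vertex good) δ₀ pat pat-ends pat-sparse first-single
... | A , c , (proper , bounded) , rooted = subdivision (rooted y (embed-outside _))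
  where
    open InducedComplement D A
    induced-dichromatic : DichromaticAtLeast induced m
    induced-dichromatic j j<m (c′ , proper′) = dich (suc K + j)
      (subst (suc K + j <_) (ℕ.+-comm (suc K) m) (ℕ.+-monoʳ-< (suc K) j<m))
      (combined-colourable proper (s≤s ∘ bounded) proper′)
    open Attaching F v₀ K Q good out D A induced embed embed-injective embed-outside id (F≤m size induced induced-dichromatic)

theorem3p1 : ∀ {n} (F : Digraph n) (v₀ : Fin n) (k : ℕ) (hk : 1 ≤ k)
    (Q : Digraph k) → Good k hk Q → (out : Bool) →
    ∀ m m* → IsMader F m → IsMader (Fstar F v₀ k hk Q out) m* →
    m* ≤ m + k
theorem3p1 F v₀ (suc K) (s≤s z≤n) Q good out m m* (F≤m , _) (_ , minimal) =
  ℕ.≮⇒≥ (λ m+k<m* → minimal (m + suc K) m+k<m* (maderBound-Fstar F v₀ K Q good out F≤m))
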